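{- Let $G=(L\cup R,E)$ be a bipartite graph that is a 2-biplex, with $m=|E|$ and $n=|L|+|R|$, and let $\beta$ be the exact number of maximal bicliques in $G$. Then all maximal bicliques in $G$ can be enumerated in $O(m+n\cdot\beta)$ time.
   Context: $G=(L\cup R,E)$ is an unweighted undirected bipartite graph with disjoint vertex sides $L,R$ and $E\subseteq L\times R$. A bipartite graph is a $k$-biplex if each vertex (on either side) has at most $k$ non-neighbors on the opposite side; a 2-biplex is the case $k=2$. A biclique of $G$ is an induced subgraph $G[V_L\cup V_R]$ with $V_L\subseteq L$, $V_R\subseteq R$ in which every $u\in V_L$ is adjacent to every $v\in V_R$; it is maximal if no other biclique of $G$ contains it. In the paper's enumeration problem the returned maximal bicliques have at least one vertex on each side. Running time is worst-case time, including the time to output the bicliques. -}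

module Defs where

open import Data.Bool using (Bool; true; false)
open import Data.Fin using (Fin; toℕ)
open import Data.Fin.Properties using (all?)
open import Data.Fin.Subset using (Subset; inside; outside; _∈_; _⊆_; Nonempty)
open import Data.Fin.Subset.Properties using (_∈?_; _⊆?_; nonempty?; anySubset?)
open import Data.List
  using (List; []; _∷_; _++_; map; length; filter; concat; take; tabulate; upTo; allFin; cartesianProduct)
import Data.List.Membership.Propositional as List
open import Data.List.Relation.Binary.Pointwise using (Pointwise)
open import Data.List.Relation.Unary.Unique.Propositional using (Unique)
open import Data.Nat using (ℕ; zero; suc; pred; _+_; _≤_; _≡ᵇ_; _<ᵇ_)
open import Data.Product using (_×_; _,_; ∃-syntax; proj₁; proj₂)
open import Data.Product.Properties using () renaming (≡-dec to ×-≡-dec)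
open import Data.Vec using ([]; _∷_)
open import Data.Vec.Properties using () renaming (≡-dec to Vec-≡-dec)
import Data.Bool as Bool
open import Function using (_∘_; _⇔_)
open import Relation.Binary using (Decidable; DecidableEquality)
open import Relation.Binary.PropositionalEquality using (_≡_)
open import Relation.Nullary using (Dec; ¬?; _×-dec_; _→-dec_)
open import Relation.Nullary.Decidable using (map′; decidable-stable)
import Relation.Unary as U

------------------------------------------------------------------------
-- Bipartite graphs, biplexes and bicliques

-- The sides are Fin l and Fin r; they are disjoint because they are
-- never mixed in one type.
record BipartiteGraph : Set₁ where
  field
    l r  : ℕ
    Adj  : Fin l → Fin r → Set
    Adj? : Decidable Adj

  order : ℕ
  order = l + r

  size : ℕ
  size = length (filter (λ (u , v) → Adj? u v) (cartesianProduct (allFin l) (allFin r)))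

  nonNeighboursˡ : Fin l → List (Fin r)
  nonNeighboursˡ u = filter (λ v → ¬? (Adj? u v)) (allFin r)

  nonNeighboursʳ : Fin r → List (Fin l)
  nonNeighboursʳ v = filter (λ u → ¬? (Adj? u v)) (allFin l)

IsBiplex : ℕ → BipartiteGraph → Set
IsBiplex k G =
  (∀ u → length (nonNeighboursˡ u) ≤ k) × (∀ v → length (nonNeighboursʳ v) ≤ k)
  where open BipartiteGraph G

allSubsets : ∀ n → List (Subset n)
allSubsets zero    = [] ∷ []
allSubsets (suc n) = map (outside ∷_) (allSubsets n) ++ map (inside ∷_) (allSubsets n)

allSubset? : ∀ {n} {P : Subset n → Set} → U.Decidable P → Dec (∀ S → P S)
allSubset? P? = map′
  (λ ¬∃¬ S → decidable-stable (P? S) λ ¬p → ¬∃¬ (S , ¬p))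
  (λ ∀p (S , ¬p) → ¬p (∀p S))
  (¬? (anySubset? λ S → ¬? (P? S)))

module _ (G : BipartiteGraph) where
  open BipartiteGraph G

  -- The pair (S , T) stands for the induced subgraph G[S ∪ T].
  VertexSet : Set
  VertexSet = Subset l × Subset r

  _⊑_ : VertexSet → VertexSet → Set
  (S , T) ⊑ (S′ , T′) = S ⊆ S′ × T ⊆ T′

  IsBiclique : VertexSet → Set
  IsBiclique (S , T) = ∀ u → u ∈ S → ∀ v → v ∈ T → Adj u v

  IsMaximal : VertexSet → Set
  IsMaximal B = ∀ S′ T′ → IsBiclique (S′ , T′) → B ⊑ (S′ , T′) → B ≡ (S′ , T′)

  -- Only bicliques with a vertex on each side are enumerated and counted.
  IsMaximalBiclique : VertexSet → Set
  IsMaximalBiclique B =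
    IsBiclique B × IsMaximal B × Nonempty (proj₁ B) × Nonempty (proj₂ B)

  private
    _≟_ : DecidableEquality VertexSet
    _≟_ = ×-≡-dec (Vec-≡-dec Bool._≟_) (Vec-≡-dec Bool._≟_)

  isBiclique? : U.Decidable IsBiclique
  isBiclique? (S , T) =
    all? λ u → u ∈? S →-dec all? λ v → v ∈? T →-dec Adj? u v

  isMaximal? : U.Decidable IsMaximal
  isMaximal? (S , T) = allSubset? λ S′ → allSubset? λ T′ →
    isBiclique? (S′ , T′) →-dec
    (S ⊆? S′ ×-dec T ⊆? T′) →-dec
    (S , T) ≟ (S′ , T′)

  isMaximalBiclique? : U.Decidable IsMaximalBiclique
  isMaximalBiclique? B@(S , T) =
    isBiclique? B ×-dec isMaximal? B ×-dec nonempty? S ×-dec nonempty? T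

  β : ℕ
  β = length (filter isMaximalBiclique? (cartesianProduct (allSubsets l) (allSubsets r)))

-- xs lists every element satisfying P exactly once, in any order.
Enumerates : {A : Set} → (A → Set) → List A → Set
Enumerates P xs = Unique xs × (∀ x → x List.∈ xs ⇔ P x)

------------------------------------------------------------------------
-- Machine model
--
-- Structured programs for a unit-cost random-access machine.  A program
-- uses finitely many scalar variables and finitely many arrays, all named
-- by numbers; array access takes one step whatever the address.  The only
-- arithmetic is successor and predecessor, so a run of t steps never
-- produces a word exceeding (largest input word or program constant) + t:
-- unit cost cannot be abused to pack long data into one word.

data Expr : Set where
  lit    : ℕ → Expr
  var    : ℕ → Expr
  _⟨_⟩   : ℕ → Expr → Expr      -- a ⟨ e ⟩ : entry e of array a
  inc    : Expr → Expr
  dec    : Expr → Expr          -- dec of 0 is 0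

data Test : Set where
  _==_ _<<_ : Expr → Expr → Test

infix  5 _≔_ _⟨_⟩≔_
infixr 4 _⨾_

data Program : Set where
  skip          : Program
  _≔_           : ℕ → Expr → Program
  _⟨_⟩≔_        : ℕ → Expr → Expr → Program
  _⨾_           : Program → Program → Program
  if_then_else_ : Test → Program → Program → Program
  while_loop_     : Test → Program → Program
  print         : Expr → Program

record State : Set where
  constructor state
  field
    vars   : ℕ → ℕ
    arrays : ℕ → ℕ → ℕ

open State

update : {A : Set} → (ℕ → A) → ℕ → A → (ℕ → A)
update f i a j = Bool.if i ≡ᵇ j then a else f j

setVar : ℕ → ℕ → State → State
setVar x w s = state (update (vars s) x w) (arrays s)

setEntry : ℕ → ℕ → ℕ → State → State
setEntry a i w s = state (vars s) (update (arrays s) a (update (arrays s a) i w))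

⟦_⟧ : Expr → State → ℕ
⟦ lit k   ⟧ s = k
⟦ var x   ⟧ s = vars s x
⟦ a ⟨ e ⟩ ⟧ s = arrays s a (⟦ e ⟧ s)
⟦ inc e   ⟧ s = suc (⟦ e ⟧ s)
⟦ dec e   ⟧ s = pred (⟦ e ⟧ s)

⟦_⟧ᵗ : Test → State → Bool
⟦ e == f ⟧ᵗ s = ⟦ e ⟧ s ≡ᵇ ⟦ f ⟧ s
⟦ e << f ⟧ᵗ s = ⟦ e ⟧ s <ᵇ ⟦ f ⟧ s

cost : Expr → ℕ
cost (lit k)   = 1
cost (var x)   = 1
cost (a ⟨ e ⟩) = suc (cost e)
cost (inc e)   = suc (cost e)
cost (dec e)   = suc (cost e)

costᵗ : Test → ℕ
costᵗ (e == f) = suc (cost e + cost f)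
costᵗ (e << f) = suc (cost e + cost f)

-- Run p s s′ o t : started in s, program p halts in s′ after t steps,
-- having printed the words o.
data Run : Program → State → State → List ℕ → ℕ → Set where

  run-skip : ∀ {s} → Run skip s s [] 1

  run-var : ∀ {x e s} →
    Run (x ≔ e) s (setVar x (⟦ e ⟧ s) s) [] (suc (cost e))

  run-entry : ∀ {a e f s} →
    Run (a ⟨ e ⟩≔ f) s (setEntry a (⟦ e ⟧ s) (⟦ f ⟧ s) s) [] (suc (cost e + cost f))

  run-seq : ∀ {p q s s′ s″ o o′ t t′} →
    Run p s s′ o t → Run q s′ s″ o′ t′ →
    Run (p ⨾ q) s s″ (o ++ o′) (t + t′)

  run-then : ∀ {b p q s s′ o t} → ⟦ b ⟧ᵗ s ≡ true →
    Run p s s′ o t → Run (if b then p else q) s s′ o (costᵗ b + t)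

  run-else : ∀ {b p q s s′ o t} → ⟦ b ⟧ᵗ s ≡ false →
    Run q s s′ o t → Run (if b then p else q) s s′ o (costᵗ b + t)

  run-stop : ∀ {b p s} → ⟦ b ⟧ᵗ s ≡ false →
    Run (while b loop p) s s [] (costᵗ b)

  run-loop : ∀ {b p s s′ s″ o o′ t t′} → ⟦ b ⟧ᵗ s ≡ true →
    Run p s s′ o t → Run (while b loop p) s′ s″ o′ t′ →
    Run (while b loop p) s s″ (o ++ o′) (costᵗ b + (t + t′))

  run-print : ∀ {e s} → Run (print e) s s (⟦ e ⟧ s ∷ []) (suc (cost e))

------------------------------------------------------------------------
-- Input: adjacency lists, each in an arbitrary order

record AdjacencyLists (G : BipartiteGraph) : Set where
  open BipartiteGraph G
  field
    listˡ  : Fin l → List (Fin r)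
    listʳ  : Fin r → List (Fin l)
    listˡ✓ : ∀ u → Enumerates (λ v → Adj u v) (listˡ u)
    listʳ✓ : ∀ v → Enumerates (λ u → Adj u v) (listʳ v)

-- The concatenation of all lists, and the array of a + 1 positions at
-- which the successive lists start and the last one ends.
targets : ∀ {a b} → (Fin a → List (Fin b)) → List ℕ
targets f = concat (tabulate (map toℕ ∘ f))

offsets : ∀ {a b} → (Fin a → List (Fin b)) → List ℕ
offsets {a} f = map (λ k → length (concat (take k (tabulate f)))) (upTo (suc a))

load : List ℕ → ℕ → ℕ
load []       _       = 0
load (x ∷ xs) zero    = x
load (x ∷ xs) (suc i) = load xs i

-- Variables 0 and 1 hold |L| and |R|; arrays 0 and 1 hold the adjacency
-- lists of the left vertices, arrays 2 and 3 those of the right vertices.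
-- All remaining memory is 0.
initial : (G : BipartiteGraph) → AdjacencyLists G → State
initial G A = state (load (l ∷ r ∷ [])) memory
  where
  open BipartiteGraph G
  open AdjacencyLists A
  memory : ℕ → ℕ → ℕ
  memory 0 = load (offsets listˡ)
  memory 1 = load (targets listˡ)
  memory 2 = load (offsets listʳ)
  memory 3 = load (targets listʳ)
  memory _ = load []

------------------------------------------------------------------------
-- Output

-- A vertex set is printed as its left vertices, 0, its right vertices, 0,
-- where vertex i of either side is printed as i + 1.
Prints : (G : BipartiteGraph) → List ℕ → VertexSet G → Set
Prints G o (S , T) = ∃[ us ] ∃[ vs ]
  Enumerates (_∈ S) us × Enumerates (_∈ T) vs ×
  o ≡ map (suc ∘ toℕ) us ++ 0 ∷ map (suc ∘ toℕ) vs ++ 0 ∷ []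

PrintsMaximalBicliques : BipartiteGraph → List ℕ → Set
PrintsMaximalBicliques G o = ∃[ Bs ] ∃[ os ]
  Enumerates (IsMaximalBiclique G) Bs × Pointwise (Prints G) os Bs × o ≡ concat os

-- Write N(x) for the at most two non-neighbours of a vertex x.  A maximal biclique
-- is determined by its left side S, and S occurs as a left side exactly when every
-- left vertex outside S has a non-neighbour v with N(v) disjoint from S.  Restricted
-- to the first i left vertices, this condition passes from i + 1 to i, and a set
-- satisfying it for i satisfies it for i + 1 either as it is or with vertex i + 1
-- added.  So deciding the left vertices one by one, and pruning as soon as the
-- condition fails, gives a search tree without dead ends whose leaves are all these
-- sets S, and all but at most two leaves (those with an empty side) are maximal
-- bicliques.  As degrees in the complement are at most 2, each test takes constant
-- time, so a leaf is charged O(n) for its branch and its output.  Finding all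
-- non-neighbours takes O(|L||R|) = O(m + n) time, and n is at most nβ once there is
-- an edge.
module Submission where

open import Defs
open import Data.Bool using (Bool; true; false; not) renaming (T to IsTrue)
open import Data.Bool.Properties using (T-≡)
open import Data.Empty using (⊥)
open import Data.Fin using (Fin; zero; suc; toℕ; fromℕ<)
open import Data.Fin.Properties using (toℕ<n; toℕ-fromℕ<; fromℕ<-toℕ; toℕ-injective; all?; ¬∀⟶∃¬)
open import Data.Fin.Subset using (Subset; _∈_; _⊆_; inside; outside)
open import Data.Fin.Subset.Properties using (⊆-antisym; _∈?_)
open import Data.List using (List; []; _∷_; _++_; length; concat; map; take; tabulate; filter; upTo; applyUpTo; allFin; cartesianProduct; _ʳ++_; replicate)
open import Data.List.Membership.Propositional using () renaming (_∈_ to _∈ₗ_)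
open import Data.List.Membership.Propositional.Properties using (∈-∃++; ∈-++⁺ˡ; ∈-++⁺ʳ; ∈-++⁻; ∈-map⁺; ∈-map⁻; ∈-filter⁺; ∈-filter⁻; ∈-allFin; ∈-cartesianProduct⁺)
open import Data.List.Properties using (++-assoc; ++-identityʳ; length-++; length-map; length-tabulate; map-++; concat-++; filter-++)
open import Data.List.Relation.Binary.Pointwise using (Pointwise; []; _∷_)
open import Data.List.Relation.Binary.Subset.Propositional using () renaming (_⊆_ to _⊆ₗ_)
open import Data.List.Relation.Unary.All as All using (All; []; _∷_)
open import Data.List.Relation.Unary.AllPairs as AllPairs using (AllPairs; []; _∷_)
open import Data.List.Relation.Unary.Any using (here; there)
open import Data.List.Relation.Unary.Unique.Propositional using (Unique)
open import Data.Nat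
open import Data.Nat.Properties
open import Data.Nat.Solver using (module +-*-Solver)
open import Data.Product using (_×_; _,_; ∃-syntax; proj₁; proj₂)
open import Data.Sum using (_⊎_; inj₁; inj₂; [_,_]′)
open import Data.Vec using (Vec; []; _∷_; toList; lookup)
open import Data.Vec.Properties using (lookup∘tabulate; []=⇒lookup; lookup⇒[]=; length-toList)
open import Function using (_∘_; id; _⇔_; mk⇔; Equivalence)
open import Relation.Binary.PropositionalEquality
open import Relation.Nullary using (¬_; Dec; yes; no; contradiction; does; _×-dec_; _⊎-dec_; _→-dec_; ¬?)
open import Relation.Nullary.Decidable using (dec-true; dec-false; decidable-stable)
import Data.Bool as Bool
import Data.List.Relation.Unary.AllPairs.Properties as AllPairs
import Data.List.Relation.Unary.Unique.Propositional.Properties as Unique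
import Data.Vec as Vec
import Relation.Unary as U

open State

-- Program logic

-- The machine has no recursion, so the tree is walked by one flat loop: `mode` tells whether the
-- walk moves away from the root or back to it, and `depth` is the length of the current path. No
-- stack is kept. The path survives only in `omit`, whose entries for the decided vertices tell
-- excluded from included. `blocks` counts for every right vertex its included non-neighbours, so an
-- inclusion raises two counters and is undone by lowering them; a zero counter means that the right
-- vertex is adjacent to all included vertices. Including a vertex can spoil the condition only at
-- omitted vertices that share a non-neighbour with it, and tables of non-neighbours for both sides
-- reach these by four lookups. Since the loop is flat, a subtree is not a run of its own; the time
-- bound is therefore proved for the whole remaining run, with what follows the subtree as a
-- parameter. Each inner node takes at most three iterations, which the leaves below it pay for.

Holds : Test → State → Set
Holds (e == f) s = ⟦ e ⟧ s ≡ ⟦ f ⟧ s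
Holds (e << f) s = ⟦ e ⟧ s < ⟦ f ⟧ s

holds? : ∀ b s → Dec (Holds b s)
holds? (e == f) s = ⟦ e ⟧ s ≟ ⟦ f ⟧ s
holds? (e << f) s = ⟦ e ⟧ s <? ⟦ f ⟧ s

holds⇒true : ∀ b {s} → Holds b s → ⟦ b ⟧ᵗ s ≡ true
holds⇒true (e == f) {s} h = Equivalence.to T-≡ (≡⇒≡ᵇ (⟦ e ⟧ s) (⟦ f ⟧ s) h)
holds⇒true (e << f) {s} h = Equivalence.to T-≡ (<⇒<ᵇ h)

¬T⇒false : ∀ {b} → ¬ IsTrue b → b ≡ false
¬T⇒false {false} _ = refl
¬T⇒false {true}  ¬t = contradiction _ ¬t

¬holds⇒false : ∀ b {s} → ¬ Holds b s → ⟦ b ⟧ᵗ s ≡ false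
¬holds⇒false (e == f) {s} ¬h = ¬T⇒false (¬h ∘ ≡ᵇ⇒≡ (⟦ e ⟧ s) (⟦ f ⟧ s))
¬holds⇒false (e << f) {s} ¬h = ¬T⇒false (¬h ∘ <ᵇ⇒< (⟦ e ⟧ s) (⟦ f ⟧ s))

record Exec (p : Program) (s : State) (T : ℕ) (Q : State → List ℕ → Set) : Set where
  constructor exec
  field
    {final}  : State
    {output} : List ℕ
    {steps}  : ℕ
    run      : Run p s final output steps
    bound    : steps ≤ T
    post     : Q final output

Silently : (State → Set) → State → List ℕ → Set
Silently Q s o = o ≡ [] × Q s

exec-weaken : ∀ {p s T U Q R} → T ≤ U → (∀ {s′ o} → Q s′ o → R s′ o) → Exec p s T Q → Exec p s U R
exec-weaken T≤U Q⇒R (exec run t≤T q) = exec run (≤-trans t≤T T≤U) (Q⇒R q)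

-- The run of `q` sits in the postcondition of the run of `p`, so it may use all that is known of
-- the intermediate state without that state being named.
exec-seq : ∀ {p q s T U Q} →
  Exec p s T (λ s′ o → Exec q s′ U (λ s″ o′ → Q s″ (o ++ o′))) → Exec (p ⨾ q) s (T + U) Q
exec-seq (exec run t≤T (exec run′ t′≤U q)) = exec (run-seq run run′) (+-mono-≤ t≤T t′≤U) q

exec-seqˢ : ∀ {p q s T U Q} →
  Exec p s T (Silently λ s′ → Exec q s′ U Q) → Exec (p ⨾ q) s (T + U) Q
exec-seqˢ (exec run t≤T (refl , q)) = exec-seq (exec run t≤T q)

after : ∀ {p s T} {Q R : State → Set} →
  Exec p s T (Silently Q) → (∀ s′ → Q s′ → R s′) → Exec p s T (Silently R)
after e Q⇒R = exec-weaken ≤-refl (λ (o≡ , q) → o≡ , Q⇒R _ q) e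

-- Only meaningful for programs that neither loop nor print.
wp : Program → (State → Set) → State → Set
wp skip                   Q s = Q s
wp (x ≔ e)                Q s = Q (setVar x (⟦ e ⟧ s) s)
wp (a ⟨ e ⟩≔ f)           Q s = Q (setEntry a (⟦ e ⟧ s) (⟦ f ⟧ s) s)
wp (p ⨾ q)                Q s = wp p (wp q Q) s
wp (if b then p else q)   Q s = (Holds b s → wp p Q s) × (¬ Holds b s → wp q Q s)
wp (while b loop p)       Q s = ⊥
wp (print e)              Q s = ⊥

-- The cost of a run in which every loop makes at most one iteration and both
-- branches of every conditional are paid for.
time : Program → ℕ
time skip                 = 1
time (x ≔ e)              = suc (cost e)
time (a ⟨ e ⟩≔ f)         = suc (cost e + cost f)
time (p ⨾ q)              = time p + time q
time (if b then p else q) = costᵗ b + (time p + time q)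
time (while b loop p)     = costᵗ b + time p + costᵗ b
time (print e)            = suc (cost e)

exec-then : ∀ b {p q s T U Q} → Holds b s → Exec p s T Q →
  Exec (if b then p else q) s (costᵗ b + (T + U)) Q
exec-then b {T = T} {U} h (exec run t≤T q) =
  exec (run-then (holds⇒true b h) run) (+-monoʳ-≤ (costᵗ b) (≤-trans t≤T (m≤m+n T U))) q

exec-else : ∀ b {p q s T U Q} → ¬ Holds b s → Exec q s U Q →
  Exec (if b then p else q) s (costᵗ b + (T + U)) Q
exec-else b {T = T} {U} ¬h (exec run t≤U q) =
  exec (run-else (¬holds⇒false b ¬h) run) (+-monoʳ-≤ (costᵗ b) (≤-trans t≤U (m≤n+m U T))) q

exec-thenᵗ : ∀ b {p q s Q} → Holds b s → Exec p s (time p) Q →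
  Exec (if b then p else q) s (time (if b then p else q)) Q
exec-thenᵗ b {p} {q} = exec-then b {p} {q}

exec-elseᵗ : ∀ b {p q s Q} → ¬ Holds b s → Exec q s (time q) Q →
  Exec (if b then p else q) s (time (if b then p else q)) Q
exec-elseᵗ b {p} {q} = exec-else b {p} {q}

exec-if : ∀ b {p q s T U Q} →
  (Holds b s → Exec p s T Q) → (¬ Holds b s → Exec q s U Q) →
  Exec (if b then p else q) s (costᵗ b + (T + U)) Q
exec-if b {s = s} th el with holds? b s
... | yes h = exec-then b h (th h)
... | no ¬h = exec-else b ¬h (el ¬h)

wp-exec : ∀ p {Q s} → wp p Q s → Exec p s (time p) (Silently Q)
wp-exec skip           q = exec run-skip ≤-refl (refl , q)
wp-exec (x ≔ e)        q = exec run-var ≤-refl (refl , q)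
wp-exec (a ⟨ e ⟩≔ f)   q = exec run-entry ≤-refl (refl , q)
wp-exec (p ⨾ p′)       q with exec run t≤ (refl , q′) ← wp-exec p q =
  exec-seq (exec run t≤ (wp-exec p′ q′))
wp-exec (if b then p else p′) (th , el) = exec-if b (wp-exec p ∘ th) (wp-exec p′ ∘ el)

wp-mono : ∀ p {Q R : State → Set} → (∀ {s} → Q s → R s) → ∀ {s} → wp p Q s → wp p R s
wp-mono skip           f = f
wp-mono (x ≔ e)        f = f
wp-mono (a ⟨ e ⟩≔ e′)  f = f
wp-mono (p ⨾ q)        f = wp-mono p (wp-mono q f)
wp-mono (if b then p else q) f (th , el) = wp-mono p f ∘ th , wp-mono q f ∘ el

-- k counts the remaining iterations, and out k is what they print.
exec-while : ∀ b p K (I : ℕ → State → Set) (out : ℕ → List ℕ) →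
  (∀ k {s} → I (suc k) s → Holds b s × Exec p s K (λ s′ o → I k s′ × o ++ out k ≡ out (suc k))) →
  (∀ {s} → I 0 s → ¬ Holds b s) → out 0 ≡ [] →
  ∀ k {s} → I k s →
  Exec (while b loop p) s (k * (costᵗ b + K) + costᵗ b) (λ s′ o → I 0 s′ × o ≡ out k)
exec-while b p K I out step stop out₀ zero i =
  exec (run-stop (¬holds⇒false b (stop i))) ≤-refl (i , sym out₀)
exec-while b p K I out step stop out₀ (suc k) i
  with h , exec {steps = t} run t≤ (i′ , eq) ← step k i
  with exec {steps = t′} run′ t′≤ (i₀ , refl) ← exec-while b p K I out step stop out₀ k i′ =
  exec (run-loop (holds⇒true b h) run run′) t″≤ (i₀ , eq)
  where
  open ≤-Reasoning
  t″≤ : costᵗ b + (t + t′) ≤ (costᵗ b + K) + k * (costᵗ b + K) + costᵗ b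
  t″≤ = begin
    costᵗ b + (t + t′)                                  ≤⟨ +-monoʳ-≤ (costᵗ b) (+-mono-≤ t≤ t′≤) ⟩
    costᵗ b + (K + (k * (costᵗ b + K) + costᵗ b))      ≡⟨ +-assoc (costᵗ b) K _ ⟨
    costᵗ b + K + (k * (costᵗ b + K) + costᵗ b)        ≡⟨ +-assoc (costᵗ b + K) _ _ ⟨
    costᵗ b + K + k * (costᵗ b + K) + costᵗ b          ∎

exec-whileˢ : ∀ b p K (I : ℕ → State → Set) →
  (∀ k {s} → I (suc k) s → Holds b s × Exec p s K (Silently (I k))) →
  (∀ {s} → I 0 s → ¬ Holds b s) →
  ∀ k {s} → I k s → Exec (while b loop p) s (k * (costᵗ b + K) + costᵗ b) (Silently (I 0))
exec-whileˢ b p K I step stop k i = exec-weaken ≤-refl (λ (i₀ , eq) → eq , i₀)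
  (exec-while b p K I (λ _ → []) step′ stop refl k i)
  where
  step′ : ∀ k {s} → I (suc k) s →
    Holds b s × Exec p s K (λ s′ o → I k s′ × o ++ [] ≡ [])
  step′ k i with h , e ← step k i =
    h , exec-weaken ≤-refl (λ { (refl , i′) → i′ , refl }) e

-- With every loop making at most N iterations, and none nested,
-- a program p runs for at most time p * suc N steps.
module Linear (N : ℕ) where

  scale : ∀ m → m ≤ m * suc N
  scale m = m≤m*n m (suc N)

  wp-execᴺ : ∀ p {Q s} → wp p Q s → Exec p s (time p * suc N) (Silently Q)
  wp-execᴺ p q = exec-weaken (scale (time p)) (λ x → x) (wp-exec p q)

  exec-seqᴺ : ∀ {p q s Q} →
    Exec p s (time p * suc N) (λ s′ o → Exec q s′ (time q * suc N) (λ s″ o′ → Q s″ (o ++ o′))) →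
    Exec (p ⨾ q) s (time (p ⨾ q) * suc N) Q
  exec-seqᴺ {p} {q} e =
    exec-weaken (≤-reflexive (sym (*-distribʳ-+ (suc N) (time p) (time q)))) (λ x → x) (exec-seq e)

  exec-seqˢᴺ : ∀ {p q s Q} →
    Exec p s (time p * suc N) (Silently λ s′ → Exec q s′ (time q * suc N) Q) →
    Exec (p ⨾ q) s (time (p ⨾ q) * suc N) Q
  exec-seqˢᴺ {p} {q} e =
    exec-weaken (≤-reflexive (sym (*-distribʳ-+ (suc N) (time p) (time q)))) (λ x → x) (exec-seqˢ e)

  exec-wpᴺ : ∀ p {q s Q} → wp p (λ s′ → Exec q s′ (time q * suc N) Q) s →
    Exec (p ⨾ q) s (time (p ⨾ q) * suc N) Q
  exec-wpᴺ p w = exec-seqˢᴺ {p} (wp-execᴺ p w)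

  branch≤ : ∀ b p q → costᵗ b + (time p * suc N + time q * suc N) ≤ time (if b then p else q) * suc N
  branch≤ b p q = begin
    costᵗ b + (time p * suc N + time q * suc N)    ≡⟨ cong (costᵗ b +_) (*-distribʳ-+ (suc N) (time p) (time q)) ⟨
    costᵗ b + (time p + time q) * suc N            ≤⟨ +-monoˡ-≤ _ (scale (costᵗ b)) ⟩
    costᵗ b * suc N + (time p + time q) * suc N    ≡⟨ *-distribʳ-+ (suc N) (costᵗ b) (time p + time q) ⟨
    time (if b then p else q) * suc N              ∎
    where open ≤-Reasoning

  exec-thenᴺ : ∀ b {p q s Q} → Holds b s → Exec p s (time p * suc N) Q →
    Exec (if b then p else q) s (time (if b then p else q) * suc N) Q
  exec-thenᴺ b {p} {q} h e = exec-weaken (branch≤ b p q) (λ x → x) (exec-then b h e)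

  exec-ifᴺ : ∀ b {p q s Q} →
    (Holds b s → Exec p s (time p * suc N) Q) → (¬ Holds b s → Exec q s (time q * suc N) Q) →
    Exec (if b then p else q) s (time (if b then p else q) * suc N) Q
  exec-ifᴺ b {p} {q} th el = exec-weaken (branch≤ b p q) (λ x → x) (exec-if b th el)

  loop≤ : ∀ b p {k} → k ≤ suc N → k * (costᵗ b + time p) + costᵗ b ≤ time (while b loop p) * suc N
  loop≤ b p {k} k≤ = begin
    k * (costᵗ b + time p) + costᵗ b                          ≤⟨ +-mono-≤ (*-monoˡ-≤ _ k≤) (scale (costᵗ b)) ⟩
    suc N * (costᵗ b + time p) + costᵗ b * suc N              ≡⟨ cong (_+ costᵗ b * suc N) (*-comm (suc N) (costᵗ b + time p)) ⟩
    (costᵗ b + time p) * suc N + costᵗ b * suc N              ≡⟨ *-distribʳ-+ (suc N) (costᵗ b + time p) (costᵗ b) ⟨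
    time (while b loop p) * suc N                             ∎
    where open ≤-Reasoning

-- Pointwise laws of array updates

update-≡ : ∀ {A : Set} (f : ℕ → A) i {w} → update f i w i ≡ w
update-≡ f i rewrite Equivalence.to T-≡ (≡⇒≡ᵇ i i refl) = refl

update-≢ : ∀ {A : Set} (f : ℕ → A) {i j w} → i ≢ j → update f i w j ≡ f j
update-≢ f {i} {j} i≢j rewrite ¬T⇒false (i≢j ∘ ≡ᵇ⇒≡ i j) = refl

update-cong : ∀ {A : Set} {f g : ℕ → A} {i w w′} → f ≗ g → w ≡ w′ → update f i w ≗ update g i w′
update-cong {i = i} f≗g refl j with i ≡ᵇ j
... | true  = refl
... | false = f≗g j

update-id : ∀ {A : Set} {f : ℕ → A} {i w} → f i ≡ w → update f i w ≗ f
update-id {f = f} {i} refl j with i ≟ j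
... | yes refl = update-≡ f i
... | no i≢j   = update-≢ f i≢j

update-update : ∀ {A : Set} {f : ℕ → A} {i w w′} → update (update f i w) i w′ ≗ update f i w′
update-update {i = i} j with i ≡ᵇ j
... | true  = refl
... | false = refl

-- Lists of positions

-- One occurrence of the head is cut out of `ys`; by uniqueness the tail stays inside the rest. All
-- counting rests on this: degrees, non-neighbours, and leaves against `β`.
unique⊆⇒length≤ : ∀ {A : Set} {xs ys : List A} → Unique xs → xs ⊆ₗ ys → length xs ≤ length ys
unique⊆⇒length≤ {xs = []}     _ _ = z≤n
unique⊆⇒length≤ {xs = x ∷ xs} (x∉xs ∷ xs!) sub with ∈-∃++ (sub (here refl))
... | as , bs , refl = begin
  suc (length xs)              ≤⟨ s≤s (unique⊆⇒length≤ xs! sub′) ⟩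
  suc (length (as ++ bs))      ≡⟨ cong suc (length-++ as) ⟩
  suc (length as + length bs)  ≡⟨ +-suc (length as) (length bs) ⟨
  length as + suc (length bs)  ≡⟨ length-++ as ⟨
  length (as ++ x ∷ bs)        ∎
  where
  open ≤-Reasoning
  sub′ : xs ⊆ₗ (as ++ bs)
  sub′ {y} y∈ with ∈-++⁻ as (sub (there y∈))
  ... | inj₁ y∈as          = ∈-++⁺ˡ y∈as
  ... | inj₂ (here y≡x)    = contradiction (sym y≡x) (All.lookup x∉xs y∈)
  ... | inj₂ (there y∈bs)  = ∈-++⁺ʳ as y∈bs

-- Descending, so that the two newest entries of a table row are at positions 0 and 1.
select : (ℕ → Bool) → ℕ → List ℕ
select P zero    = []
select P (suc n) = Bool.if P (suc n) then suc n ∷ select P n else select P n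

∈-select⁺ : ∀ P {n x} → 0 < x → x ≤ n → P x ≡ true → x ∈ₗ select P n
∈-select⁺ P {zero}  0<x z≤n px = contradiction 0<x λ ()
∈-select⁺ P {suc n} {x} 0<x x≤ px with x ≟ suc n
... | yes refl rewrite px = here refl
... | no  x≢ with P (suc n) | ∈-select⁺ P {n} 0<x (s≤s⁻¹ (≤∧≢⇒< x≤ x≢)) px
...   | true  | x∈ = there x∈
...   | false | x∈ = x∈

∈-select⁻ : ∀ P {n x} → x ∈ₗ select P n → 0 < x × x ≤ n × P x ≡ true
∈-select⁻ P {suc n} {x} x∈ with P (suc n) in eq
∈-select⁻ P {suc n} (here refl) | true = z<s , ≤-refl , eq
∈-select⁻ P {suc n} (there x∈)  | true with ∈-select⁻ P {n} x∈
... | 0<x , x≤n , px = 0<x , m≤n⇒m≤1+n x≤n , px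
∈-select⁻ P {suc n} x∈          | false with ∈-select⁻ P {n} x∈
... | 0<x , x≤n , px = 0<x , m≤n⇒m≤1+n x≤n , px

select-unique : ∀ P n → Unique (select P n)
select-unique P zero    = []
select-unique P (suc n) with P (suc n)
... | false = select-unique P n
... | true  = All.tabulate (λ x∈ eq → 1+n≰n (subst (_≤ n) (sym eq) (proj₁ (proj₂ (∈-select⁻ P x∈)))))
              ∷ select-unique P n

toFins : ∀ {n} (xs : List ℕ) → (∀ {x} → x ∈ₗ xs → 0 < x × x ≤ n) →
  ∃[ us ] map (suc ∘ toℕ {n}) us ≡ xs
toFins []       _ = [] , refl
toFins (zero  ∷ xs) h = contradiction (proj₁ (h (here refl))) λ ()
toFins (suc x ∷ xs) h with toFins xs (h ∘ there)
... | us , eq = fromℕ< (proj₂ (h (here refl))) ∷ us , cong₂ _∷_ (cong suc (toℕ-fromℕ< _)) eq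

-- Turns the numbers produced by a scan into the list of vertices that `Prints` asks for.
select-enumerates : ∀ P {n} {S : Subset n} → (∀ u → u ∈ S ⇔ P (suc (toℕ u)) ≡ true) →
  ∃[ us ] Enumerates (_∈ S) us × select P n ≡ map (suc ∘ toℕ) us
select-enumerates P {n} {S} S⇔P with toFins {n} (select P n)
  (λ x∈ → let 0<x , x≤n , _ = ∈-select⁻ P x∈ in 0<x , x≤n)
... | us , eq = us , (Unique.map⁻ (subst Unique (sym eq) (select-unique P n)) , λ u → mk⇔ (to u) (from u)) , sym eq
  where
  to : ∀ u → u ∈ₗ us → u ∈ S
  to u u∈ = Equivalence.from (S⇔P u)
    (proj₂ (proj₂ (∈-select⁻ P {n} (subst (suc (toℕ u) ∈ₗ_) eq (∈-map⁺ _ u∈)))))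
  from : ∀ u → u ∈ S → u ∈ₗ us
  from u u∈S with ∈-map⁻ (suc ∘ toℕ) (subst (suc (toℕ u) ∈ₗ_) (sym eq)
                    (∈-select⁺ P z<s (toℕ<n u) (Equivalence.to (S⇔P u) u∈S)))
  ... | u′ , u′∈ , eq′ = subst (_∈ₗ us) (sym (toℕ-injective (suc-injective eq′))) u′∈

-- Partial decisions

-- A path lists decisions about the left vertices 1, 2, … , the latest first.
Path : Set
Path = List Bool

-- Vertices are numbered from the end of the list, so extending a path does not renumber earlier
-- decisions.
data At (b : Bool) (x : ℕ) : Path → Set where
  here  : ∀ {p}   → x ≡ suc (length p) → At b x (b ∷ p)
  there : ∀ {c p} → At b x p → At b x (c ∷ p)

at-positive : ∀ {b x p} → At b x p → 0 < x
at-positive (here refl) = z<s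
at-positive (there a)   = at-positive a

at-bounded : ∀ {b x p} → At b x p → x ≤ length p
at-bounded (here refl) = ≤-refl
at-bounded (there a)   = m≤n⇒m≤1+n (at-bounded a)

at-functional : ∀ {b c x p} → At b x p → At c x p → b ≡ c
at-functional (here _)    (here _)    = refl
at-functional (here refl) (there a)   = contradiction (at-bounded a) 1+n≰n
at-functional (there a)   (here refl) = contradiction (at-bounded a) 1+n≰n
at-functional (there a)   (there a′)  = at-functional a a′

at-ʳ++ : ∀ {b x p} r → At b x p → At b x (r ʳ++ p)
at-ʳ++ []      a = a
at-ʳ++ (c ∷ r) a = at-ʳ++ r (there a)

-- Makes closedness decidable, so that the pruned tree can be defined by recursion. The program
-- never scans a path like this; it relies on local tests.
at-all? : ∀ {Q : ℕ → Set} → U.Decidable Q → ∀ b p → Dec (∀ x → At b x p → Q x)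
at-all? Q? b [] = yes λ _ ()
at-all? {Q} Q? b (c ∷ p) with at-all? Q? b p | b Bool.≟ c
... | no ¬h | _ = no λ h → ¬h λ x a → h x (there a)
... | yes h | no b≢c = yes λ { x (here _) → contradiction refl b≢c ; x (there a) → h x a }
... | yes h | yes refl with Q? (suc (length p))
...   | yes q = yes λ { x (here refl) → q ; x (there a) → h x a }
...   | no ¬q = no λ h′ → ¬q (h′ _ (here refl))

-- The intended contents of the array `omit`.
outs : Path → ℕ → ℕ
outs []          _ = 0
outs (true  ∷ p)   = outs p
outs (false ∷ p)   = update (outs p) (suc (length p)) 1

outs-at : ∀ {p x} → At false x p → outs p x ≢ 0
outs-at {false ∷ p} (here refl) eq with () ← trans (sym (update-≡ (outs p) (suc (length p)))) eq
outs-at {true ∷ p}  (there a) = outs-at a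
outs-at {false ∷ p} {x} (there a) eq = outs-at a
  (trans (sym (update-≢ (outs p) {suc (length p)} {x} λ { refl → 1+n≰n (at-bounded a) })) eq)

at-outs : ∀ p {x} → outs p x ≢ 0 → At false x p
at-outs []          ≢0 = contradiction refl ≢0
at-outs (true ∷ p)  ≢0 = there (at-outs p ≢0)
at-outs (false ∷ p) {x} ≢0 with suc (length p) ≟ x
... | yes refl = here refl
... | no ≢x = there (at-outs p (subst (_≢ 0) (update-≢ (outs p) ≢x) ≢0))

-- This is why clearing the entry of the last vertex restores `omit` on the way back.
outs-fresh : ∀ p → outs p (suc (length p)) ≡ 0
outs-fresh p with outs p (suc (length p)) ≟ 0
... | yes eq = eq
... | no ≢0  = contradiction (at-bounded (at-outs p ≢0)) 1+n≰n

bump unbump : ℕ → (ℕ → ℕ) → ℕ → ℕ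
bump   a f = update f a (suc (f a))
unbump a f = update f a (pred (f a))

bump-cong : ∀ {a b f g} → a ≡ b → f ≗ g → bump a f ≗ bump b g
bump-cong {a} refl f≗g = update-cong {i = a} f≗g (cong suc (f≗g a))

unbump-cong : ∀ {a b f g} → a ≡ b → f ≗ g → unbump a f ≗ unbump b g
unbump-cong {a} refl f≗g = update-cong {i = a} f≗g (cong pred (f≗g a))

unbump-bump : ∀ a f → unbump a (bump a f) ≗ f
unbump-bump a f x = trans (update-update {f = f} {i = a} x)
  (update-id {f = f} {i = a} (cong pred (sym (update-≡ f a))) x)

bump≡0⁻ : ∀ a f {x} → bump a f x ≡ 0 → a ≢ x × f x ≡ 0
bump≡0⁻ a f {x} eq with a ≟ x
... | yes refl with () ← trans (sym (update-≡ f a)) eq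
... | no a≢x = a≢x , trans (sym (update-≢ f a≢x)) eq

bump≡0⁺ : ∀ a f {x} → a ≢ x → f x ≡ 0 → bump a f x ≡ 0
bump≡0⁺ a f a≢x eq = trans (update-≢ f a≢x) eq

-- A₁ x and A₂ x are the non-neighbours of the left vertex x; 0 stands for none.
module Paths (A₁ A₂ : ℕ → ℕ) where

  -- Entry 0 is positive, so that a missing non-neighbour never counts as available.
  hits : Path → ℕ → ℕ
  hits []          = update (λ _ → 0) 0 1
  hits (true  ∷ p) = bump (A₂ (suc (length p))) (bump (A₁ (suc (length p))) (hits p))
  hits (false ∷ p) = hits p

  hits-include⁻ : ∀ p {v} → hits (true ∷ p) v ≡ 0 →
    A₁ (suc (length p)) ≢ v × A₂ (suc (length p)) ≢ v × hits p v ≡ 0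
  hits-include⁻ p {v} eq
    with A₂≢ , eq′ ← bump≡0⁻ (A₂ (suc (length p))) (bump (A₁ (suc (length p))) (hits p)) eq
    with A₁≢ , eq″ ← bump≡0⁻ (A₁ (suc (length p))) (hits p) eq′ = A₁≢ , A₂≢ , eq″

  hits-include⁺ : ∀ p {v} → A₁ (suc (length p)) ≢ v → A₂ (suc (length p)) ≢ v → hits p v ≡ 0 →
    hits (true ∷ p) v ≡ 0
  hits-include⁺ p A₁≢ A₂≢ eq = bump≡0⁺ (A₂ (suc (length p))) (bump (A₁ (suc (length p))) (hits p)) A₂≢
    (bump≡0⁺ (A₁ (suc (length p))) (hits p) A₁≢ eq)

  hits≡0⁻ : ∀ p {v} → hits p v ≡ 0 → ∀ {x} → At true x p → A₁ x ≢ v × A₂ x ≢ v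
  hits≡0⁻ (true ∷ p) eq a with A₁≢ , A₂≢ , eq′ ← hits-include⁻ p eq with a
  ... | here refl = A₁≢ , A₂≢
  ... | there a′  = hits≡0⁻ p eq′ a′
  hits≡0⁻ (false ∷ p) eq (there a) = hits≡0⁻ p eq a

  hits≡0⇒≢0 : ∀ p {v} → hits p v ≡ 0 → v ≢ 0
  hits≡0⇒≢0 []          () refl
  hits≡0⇒≢0 (true ∷ p)  eq = hits≡0⇒≢0 p (proj₂ (proj₂ (hits-include⁻ p eq)))
  hits≡0⇒≢0 (false ∷ p) eq = hits≡0⇒≢0 p eq

  hits≡0⁺ : ∀ p {v} → v ≢ 0 → (∀ {x} → At true x p → A₁ x ≢ v × A₂ x ≢ v) → hits p v ≡ 0
  hits≡0⁺ [] {zero}  v≢0 _ = contradiction refl v≢0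
  hits≡0⁺ [] {suc v} v≢0 _ = refl
  hits≡0⁺ (true ∷ p) v≢0 h with A₁≢ , A₂≢ ← h (here refl) =
    hits-include⁺ p A₁≢ A₂≢ (hits≡0⁺ p v≢0 (h ∘ there))
  hits≡0⁺ (false ∷ p) v≢0 h = hits≡0⁺ p v≢0 (h ∘ there)

  -- A zero counter marks a right vertex adjacent to all included vertices; as a non-neighbour of
  -- `x`, it is the reason to leave `x` out.
  Excludable : Path → ℕ → Set
  Excludable p x = hits p (A₁ x) ≡ 0 ⊎ hits p (A₂ x) ≡ 0

  excludable? : ∀ p → U.Decidable (Excludable p)
  excludable? p x = hits p (A₁ x) ≟ 0 ⊎-dec hits p (A₂ x) ≟ 0

  Closed : Path → Set
  Closed p = ∀ x → At false x p → Excludable p x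

  closed? : U.Decidable Closed
  closed? p = at-all? (excludable? p) false p

  excludable-tail : ∀ b p {x} → Excludable (b ∷ p) x → Excludable p x
  excludable-tail false p e        = e
  excludable-tail true  p (inj₁ z) = inj₁ (proj₂ (proj₂ (hits-include⁻ p z)))
  excludable-tail true  p (inj₂ z) = inj₂ (proj₂ (proj₂ (hits-include⁻ p z)))

  closed-tail : ∀ b {p} → Closed (b ∷ p) → Closed p
  closed-tail b {p} c x a = excludable-tail b p (c x (there a))

  closed-suffix : ∀ r {p} → Closed (r ʳ++ p) → Closed p
  closed-suffix []      c = c
  closed-suffix (b ∷ r) c = closed-tail b (closed-suffix r c)

  closed-exclude : ∀ {p} → Closed p → Excludable p (suc (length p)) → Closed (false ∷ p)
  closed-exclude c e x (here refl) = e
  closed-exclude c e x (there a)   = c x a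

  excludable-head : ∀ {p} → Closed (false ∷ p) → Excludable p (suc (length p))
  excludable-head c = c _ (here refl)

  -- If the next vertex cannot be excluded, all its non-neighbours are hit
  -- already, so including it leaves every available vertex available.
  closed-include : ∀ {p} → Closed p → ¬ Excludable p (suc (length p)) → Closed (true ∷ p)
  closed-include {p} c ¬e x (there a) = [ inj₁ ∘ still , inj₂ ∘ still ]′ (c x a)
    where
    still : ∀ {v} → hits p v ≡ 0 → hits (true ∷ p) v ≡ 0
    still z = hits-include⁺ p (λ eq → ¬e (inj₁ (trans (cong (hits p) eq) z)))
      (λ eq → ¬e (inj₂ (trans (cong (hits p) eq) z))) z

  -- The contrapositive of `closed-include`. It allows the program to exclude a vertex after a
  -- failed inclusion without a further test.
  must-exclude : ∀ {p} → Closed p → ¬ Closed (true ∷ p) → Excludable p (suc (length p))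
  must-exclude {p} c ¬c₁ with excludable? p (suc (length p))
  ... | yes e = e
  ... | no ¬e = contradiction (closed-include c ¬e) ¬c₁

  -- `k` is the number of undecided vertices. The included branch comes before the excluded one, as
  -- in the walk of the program, so that outputs can be compared as lists.
  leaves : ℕ → Path → List Path
  branch : ℕ → Path → List Path
  leaves zero    p = p ∷ []
  leaves (suc k) p = branch k (true ∷ p) ++ branch k (false ∷ p)
  branch k p = Bool.if does (closed? p) then leaves k p else []

  leaves⁻ : ∀ k {p q} → Closed p → q ∈ₗ leaves k p → Closed q × ∃[ r ] length r ≡ k × q ≡ r ʳ++ p
  branch⁻ : ∀ k {p q} → q ∈ₗ branch k p → Closed q × ∃[ r ] length r ≡ k × q ≡ r ʳ++ p
  leaves⁻ zero    c (here refl) = c , [] , refl , refl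
  leaves⁻ (suc k) {p} c q∈ with ∈-++⁻ (branch k (true ∷ p)) q∈
  ... | inj₁ q∈ˡ with cq , r , len , eq ← branch⁻ k q∈ˡ = cq , true ∷ r , cong suc len , eq
  ... | inj₂ q∈ʳ with cq , r , len , eq ← branch⁻ k q∈ʳ = cq , false ∷ r , cong suc len , eq
  branch⁻ k {p} q∈ with closed? p
  ... | yes c = leaves⁻ k c q∈
  ... | no _ with () ← q∈

  leaves⁺ : ∀ r {p} → Closed (r ʳ++ p) → (r ʳ++ p) ∈ₗ leaves (length r) p
  branch⁺ : ∀ r {p} → Closed (r ʳ++ p) → (r ʳ++ p) ∈ₗ branch (length r) p
  leaves⁺ []          c = here refl
  leaves⁺ (true  ∷ r) c = ∈-++⁺ˡ (branch⁺ r c)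
  leaves⁺ (false ∷ r) {p} c = ∈-++⁺ʳ (branch (length r) (true ∷ p)) (branch⁺ r c)
  branch⁺ r {p} c with closed? p
  ... | yes _ = leaves⁺ r c
  ... | no ¬c = contradiction (closed-suffix r c) ¬c

  -- A separating vertex is kept instead of mere inequality, because it separates the left sides of
  -- the two leaves as well as their paths.
  Apart : Path → Path → Set
  Apart p q = ∃[ x ] At true x p × At false x q

  leaves-apart : ∀ k {p} → Closed p → AllPairs Apart (leaves k p)
  branch-apart : ∀ k p → AllPairs Apart (branch k p)
  leaves-apart zero    c = [] ∷ []
  leaves-apart (suc k) {p} c = AllPairs.++⁺ (branch-apart k _) (branch-apart k _)
    (All.tabulate λ q∈ → All.tabulate λ q′∈ → split (branch⁻ k q∈) (branch⁻ k q′∈))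
    where
    split : ∀ {q q′} → Closed q × ∃[ r ] length r ≡ k × q ≡ r ʳ++ true ∷ p →
      Closed q′ × ∃[ r ] length r ≡ k × q′ ≡ r ʳ++ false ∷ p → Apart q q′
    split (_ , r , _ , refl) (_ , r′ , _ , refl) =
      _ , at-ʳ++ r (here refl) , at-ʳ++ r′ (here refl)
  branch-apart k p with closed? p
  ... | yes c = leaves-apart k c
  ... | no _  = []

  -- The fact behind the charging: every visited node has a leaf below it that can pay for its
  -- iterations.
  leaves-nonempty : ∀ k {p} → Closed p → 1 ≤ length (leaves k p)
  leaves-nonempty zero    c = ≤-refl
  leaves-nonempty (suc k) {p} c rewrite length-++ (branch k (true ∷ p)) {branch k (false ∷ p)}
    with closed? (true ∷ p) | closed? (false ∷ p)
  ... | yes c₁ | _      = ≤-trans (leaves-nonempty k c₁) (m≤m+n _ _)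
  ... | no _   | yes c₀ = leaves-nonempty k c₀
  ... | no ¬c₁ | no ¬c₀ = contradiction (closed-exclude c (must-exclude c ¬c₁)) ¬c₀

  branch-full : ∀ k {p} → Closed p → branch k p ≡ leaves k p
  branch-full k {p} c rewrite dec-true (closed? p) c = refl

  branch-empty : ∀ k {p} → ¬ Closed p → branch k p ≡ []
  branch-empty k {p} ¬c rewrite dec-false (closed? p) ¬c = refl

-- The search

-- The first group of names are variables, the second arrays.
nˡ nʳ row pos col depth mode halted count ok vtx : ℕ
nˡ = 0
nʳ = 1
row = 2
pos = 3
col = 4
depth = 5
mode = 6
halted = 7
count = 8
ok = 9
vtx = 10

start target mark non¹ˡ non²ˡ non¹ʳ non²ʳ blocks omit : ℕ
start = 0
target = 1
mark = 4
non¹ˡ = 5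
non²ˡ = 6
non¹ʳ = 7
non²ʳ = 8
blocks = 9
omit = 10

-- Counting down gives the order of `select` and stops before entry 0, which stands for no vertex.
scan : ℕ → ℕ → Program → Program
scan a n p =
  col ≔ var n ⨾
  while lit 0 << var col loop
    ((if (a ⟨ var col ⟩) == lit 0 then p else skip) ⨾ col ≔ dec (var col))

tally list : ℕ → ℕ → Program
tally a n = count ≔ lit 0 ⨾ scan a n (count ≔ inc (var count))
list  a n = scan a n (print (var col)) ⨾ print (lit 0)

-- Both sides are counted before anything is printed, since output cannot be taken back.
leaf : Program
leaf =
  tally omit nˡ ⨾
  if lit 0 << var count then
    (tally blocks nʳ ⨾
     if lit 0 << var count then list omit nˡ ⨾ list blocks nʳ else skip)
  else skip

-- Applied to `outs p` and `hits p`, this lists the left and the right side described by `p`.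
zeros : (ℕ → ℕ) → ℕ → List ℕ
zeros f = select (λ x → f x ≡ᵇ 0)

zeros-hit : ∀ f {n} → f (suc n) ≡ 0 → zeros f (suc n) ≡ suc n ∷ zeros f n
zeros-hit f eq rewrite eq = refl

zeros-miss : ∀ f {n} → f (suc n) ≢ 0 → zeros f (suc n) ≡ zeros f n
zeros-miss f {n} ≢0 with f (suc n)
... | zero  = contradiction refl ≢0
... | suc _ = refl

-- Scanning one side of the graph

module Scan (N : ℕ) (K : State → Set)
  (keep-col : ∀ s w → K s → K (setVar col w s))
  (keep-count : ∀ s w → K s → K (setVar count w s)) where

  open Linear N

  module _ (a : ℕ) (f : ℕ → ℕ) (reads : ∀ s → K s → arrays s a ≗ f) where

    tally-exec : ∀ n {m} s → K s → (∀ {w} → vars (setVar count w s) n ≡ m) → m ≤ N →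
      Exec (tally a n) s (time (tally a n) * suc N)
        (Silently λ s′ → K s′ × vars s′ count ≡ length (zeros f m))
    tally-exec n {m} s k eq m≤N =
      exec-wpᴺ (count ≔ lit 0) (exec-wpᴺ (col ≔ var n)
        (exec-weaken (loop≤ (lit 0 << var col) body (m≤n⇒m≤1+n m≤N))
          (λ { (o≡ , k , _ , eq′) → o≡ , k , trans (sym (+-identityʳ _)) eq′ })
          (exec-whileˢ (lit 0 << var col) body (time body) I step
            (λ { (_ , col≡ , _) lt → <⇒≢ lt (sym col≡) })
            m (keep-col _ _ (keep-count _ _ k) , eq , refl))))
      where
      body : Program
      body = (if (a ⟨ var col ⟩) == lit 0 then count ≔ inc (var count) else skip) ⨾ col ≔ dec (var col)
      -- What is counted already and what is still ahead add up to the total.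
      I : ℕ → State → Set
      I j s = K s × vars s col ≡ j × vars s count + length (zeros f j) ≡ length (zeros f m)
      step : ∀ j {s} → I (suc j) s → Holds (lit 0 << var col) s × Exec body s (time body) (Silently (I j))
      step j {s} (k , c≡ , inv) = subst (0 <_) (sym c≡) z<s , wp-exec body
        ( (λ z → keep-col _ _ (keep-count _ _ k) , cong pred c≡ ,
             trans (sym (+-suc (vars s count) _)) (trans (cong (λ xs → vars s count + length xs) (sym (zeros-hit f (trans (sym (entry≡ k c≡)) z)))) inv))
        , (λ nz → keep-col _ _ k , cong pred c≡ ,
             trans (cong (λ xs → vars s count + length xs) (sym (zeros-miss f (nz ∘ trans (entry≡ k c≡))))) inv) )
        where
        entry≡ : K s → vars s col ≡ suc j → arrays s a (vars s col) ≡ f (suc j)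
        entry≡ k c≡ = trans (reads s k _) (cong f c≡)

    list-exec : ∀ n {m} s → K s → vars s n ≡ m → m ≤ N →
      Exec (list a n) s (time (list a n) * suc N) (λ s′ o → K s′ × o ≡ zeros f m ++ 0 ∷ [])
    list-exec n {m} s k eq m≤N =
      exec-seqᴺ {scan a n (print (var col))} {print (lit 0)}
      (exec-wpᴺ (col ≔ var n)
        (exec-weaken (loop≤ (lit 0 << var col) body (m≤n⇒m≤1+n m≤N))
          (λ { ((k , _) , refl) → exec run-print (scale 2) (k , refl) })
          (exec-while (lit 0 << var col) body (time body) I (zeros f) step
            (λ { (_ , col≡) lt → <⇒≢ lt (sym col≡) }) refl m (keep-col _ _ k , eq))))
      where
      body : Program
      body = (if (a ⟨ var col ⟩) == lit 0 then print (var col) else skip) ⨾ col ≔ dec (var col)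
      I : ℕ → State → Set
      I j s = K s × vars s col ≡ j
      step : ∀ j {s} → I (suc j) s → Holds (lit 0 << var col) s ×
        Exec body s (time body) (λ s′ o → I j s′ × o ++ zeros f j ≡ zeros f (suc j))
      step j {s} (k , c≡) = subst (0 <_) (sym c≡) z<s , exec-seq (exec-if ((a ⟨ var col ⟩) == lit 0)
        (λ z → exec run-print ≤-refl (exec run-var ≤-refl ((keep-col _ _ k , cong pred c≡) ,
          trans (cong (_∷ zeros f j) c≡) (sym (zeros-hit f (trans (sym entry≡) z))))))
        (λ nz → exec run-skip ≤-refl (exec run-var ≤-refl ((keep-col _ _ k , cong pred c≡) ,
          sym (zeros-miss f (nz ∘ trans entry≡))))))
        where
        entry≡ : arrays s a (vars s col) ≡ f (suc j)
        entry≡ = trans (reads s k _) (cong f c≡)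

first second : Expr
first  = non¹ˡ ⟨ var vtx ⟩
second = non²ˡ ⟨ var vtx ⟩

-- `uninclude` works in the reverse order of `include`, so each decrement cancels the increment it
-- meets, even if both addresses agree.
include uninclude exclude : Program
include   = blocks ⟨ first ⟩≔ inc (blocks ⟨ first ⟩) ⨾ blocks ⟨ second ⟩≔ inc (blocks ⟨ second ⟩)
uninclude = blocks ⟨ second ⟩≔ dec (blocks ⟨ second ⟩) ⨾ blocks ⟨ first ⟩≔ dec (blocks ⟨ first ⟩)
exclude   = omit ⟨ var vtx ⟩≔ lit 1

-- A vertex that is not omitted passes at once; so does 0, which fills the places of missing
-- non-neighbours.
check : Expr → Program
check e =
  if (omit ⟨ e ⟩) == lit 0 then skip else
  if (blocks ⟨ non¹ˡ ⟨ e ⟩ ⟩) == lit 0 then skip else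
  if (blocks ⟨ non²ˡ ⟨ e ⟩ ⟩) == lit 0 then skip else
  (ok ≔ lit 0)

tryInclude resolve descend retreat body search : Program

-- The counters are raised ahead of the tests, which must read them as they are after the inclusion.
tryInclude = vtx ≔ inc (var depth) ⨾ include ⨾ ok ≔ lit 1

resolve =
  depth ≔ var vtx ⨾
  if var ok == lit 0 then uninclude ⨾ exclude else skip

descend =
  tryInclude ⨾
  check (non¹ʳ ⟨ first ⟩) ⨾ check (non²ʳ ⟨ first ⟩) ⨾
  check (non¹ʳ ⟨ second ⟩) ⨾ check (non²ʳ ⟨ second ⟩) ⨾
  resolve

turn : Program
turn = exclude ⨾ depth ≔ var vtx ⨾ mode ≔ lit 0

retreat =
  vtx ≔ var depth ⨾ depth ≔ dec (var depth) ⨾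
  -- Entry 0 means that the included branch has just been left, so the excluded branch may still be
  -- due.
  if (omit ⟨ var vtx ⟩) == lit 0
  then uninclude ⨾
    (if (blocks ⟨ first ⟩) == lit 0 then turn else
     if (blocks ⟨ second ⟩) == lit 0 then turn else skip)
  else (omit ⟨ var vtx ⟩≔ lit 0)

body =
  if var mode == lit 0
  then (if var depth == var nˡ then leaf ⨾ mode ≔ lit 1 else descend)
  else (if var depth == lit 0 then halted ≔ lit 1 else retreat)

stay : Test
stay = var halted == lit 0

search = while stay loop body

-- Bounds an iteration away from the leaves. At a leaf, whose scans are loops, the factor
-- `suc (l + r)` is added.
iterationCost : ℕ
iterationCost = costᵗ stay + time body

-- Simulation of the tree walk

module Search (l r : ℕ) (A₁ A₂ B₁ B₂ : ℕ → ℕ)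
  (B-complete : ∀ {x v} → 0 < x → x ≤ l → v ≢ 0 → A₁ x ≡ v ⊎ A₂ x ≡ v → B₁ v ≡ x ⊎ B₂ v ≡ x)
  where

  open Paths A₁ A₂
  open Linear (l + r)

  Fixed : State → Set
  Fixed s = vars s nˡ ≡ l × vars s nʳ ≡ r × vars s halted ≡ 0 ×
    arrays s non¹ˡ ≡ A₁ × arrays s non²ˡ ≡ A₂ × arrays s non¹ʳ ≡ B₁ × arrays s non²ʳ ≡ B₂

  -- `m` is 0 on the way to the leaves and 1 on the way back. The two changing arrays are known only
  -- pointwise, because cancelling updates restore the values of a function and not the function
  -- itself.
  Node : ℕ → Path → State → Set
  Node m p s = Fixed s × vars s mode ≡ m × vars s depth ≡ length p ×
    arrays s blocks ≗ hits p × arrays s omit ≗ outs p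

  -- The state during the tests: the counters already belong to `true ∷ p`, the omissions still to
  -- `p`.
  Trial : Path → State → Set
  Trial p s = Fixed s × vars s mode ≡ 0 × vars s vtx ≡ suc (length p) ×
    arrays s blocks ≗ hits (true ∷ p) × arrays s omit ≗ outs p

  tryInclude-wp : ∀ {p s} → Node 0 p s → wp tryInclude (λ s′ → Trial p s′ × vars s′ ok ≡ 1) s
  tryInclude-wp (fixed@(_ , _ , _ , a₁ , a₂ , _) , m≡ , d≡ , hits≗ , outs≗) =
    (fixed , m≡ , cong suc d≡ ,
      bump-cong (cong₂ (λ f i → f (suc i)) a₂ d≡) (bump-cong (cong₂ (λ f i → f (suc i)) a₁ d≡) hits≗) ,
      outs≗) , refl

  Passes : Path → ℕ → Set
  Passes p x = outs p x ≢ 0 → Excludable (true ∷ p) x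

  -- A failure at any omitted vertex refutes closedness of `true ∷ p`; only for a success does it
  -- matter which vertices were tested.
  Verdict : Path → List ℕ → State → Set
  Verdict p xs s = Trial p s ×
    (vars s ok ≡ 1 × All (Passes p) xs ⊎ vars s ok ≡ 0 × ∃[ x ] ¬ Passes p x)

  check-wp : ∀ {p xs s} e {x} → ⟦ e ⟧ s ≡ x → Verdict p xs s → wp (check e) (Verdict p (x ∷ xs)) s
  check-wp {p} {xs} {s} e {x} refl (trial@((_ , _ , _ , a₁ , a₂ , _) , _ , _ , hits≗ , outs≗) , v) =
    (λ z → pass λ ≢0 → contradiction (trans (sym (outs≗ x)) z) ≢0) ,
    λ ≢0 → (λ z → pass λ _ → inj₁ (trans (sym first≡) z)) ,
    λ ≢1 → (λ z → pass λ _ → inj₂ (trans (sym second≡) z)) ,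
    λ ≢2 → trial , inj₂ (refl , x ,
      λ q → [ ≢1 ∘ trans first≡ , ≢2 ∘ trans second≡ ]′ (q (≢0 ∘ trans (outs≗ x))))
    where
    first≡ : arrays s blocks (arrays s non¹ˡ x) ≡ hits (true ∷ p) (A₁ x)
    first≡ = trans (cong (λ f → arrays s blocks (f x)) a₁) (hits≗ (A₁ x))
    second≡ : arrays s blocks (arrays s non²ˡ x) ≡ hits (true ∷ p) (A₂ x)
    second≡ = trans (cong (λ f → arrays s blocks (f x)) a₂) (hits≗ (A₂ x))
    pass : Passes p x → Verdict p (x ∷ xs) s
    pass px = trial , [ (λ (ok≡ , all) → inj₁ (ok≡ , px ∷ all)) , inj₂ ]′ v

  check-exec : ∀ {p xs s} e {x} → ⟦ e ⟧ s ≡ x → Verdict p xs s →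
    Exec (check e) s (time (check e)) (Silently (Verdict p (x ∷ xs)))
  check-exec {p} {xs} {s} e {x} eq v = wp-exec (check e) {Verdict p (x ∷ xs)} (check-wp {p} {s = s} e eq v)

  -- A right vertex blocked by including x is a non-neighbour of x, so every
  -- omitted vertex that relied on it is one of the four vertices tested.
  passes⇒closed : ∀ {p} → Closed p → length p < l → let x = suc (length p) in
    Passes p (B₁ (A₁ x)) → Passes p (B₂ (A₁ x)) → Passes p (B₁ (A₂ x)) → Passes p (B₂ (A₂ x)) →
    Closed (true ∷ p)
  passes⇒closed {p} c p<l p₁₁ p₂₁ p₁₂ p₂₂ y (there a) =
    [ (λ z → keep (inj₁ refl) z inj₁) , (λ z → keep (inj₂ refl) z inj₂) ]′ (c y a)
    where
    x : ℕ
    x = suc (length p)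
    use : ∀ {w} → Passes p w → w ≡ y → Excludable (true ∷ p) y
    use q refl = q (outs-at a)
    found : ∀ {v} → A₁ y ≡ v ⊎ A₂ y ≡ v → hits p v ≡ 0 → B₁ v ≡ y ⊎ B₂ v ≡ y
    found y~v z = B-complete (at-positive a) (≤-trans (at-bounded a) (<⇒≤ p<l)) (hits≡0⇒≢0 p z) y~v
    keep : ∀ {v} → A₁ y ≡ v ⊎ A₂ y ≡ v → hits p v ≡ 0 →
      (hits (true ∷ p) v ≡ 0 → Excludable (true ∷ p) y) → Excludable (true ∷ p) y
    keep {v} y~v z conclude with A₁ x ≟ v | A₂ x ≟ v
    ... | yes refl | _        = [ use p₁₁ , use p₂₁ ]′ (found y~v z)
    ... | no _     | yes refl = [ use p₁₂ , use p₂₂ ]′ (found y~v z)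
    ... | no ≢₁    | no ≢₂    = conclude (hits-include⁺ p ≢₁ ≢₂ z)

  Descended : Path → State → Set
  Descended p s = Closed (true ∷ p) × Node 0 (true ∷ p) s ⊎ ¬ Closed (true ∷ p) × Node 0 (false ∷ p) s

  uninclude-restores : ∀ p s → Fixed s → vars s vtx ≡ suc (length p) → arrays s blocks ≗ hits (true ∷ p) →
    unbump (arrays s non¹ˡ (vars s vtx)) (unbump (arrays s non²ˡ (vars s vtx)) (arrays s blocks)) ≗ hits p
  uninclude-restores p s (_ , _ , _ , a₁ , a₂ , _) v≡ hits≗ y =
    trans (unbump-cong (cong₂ (λ f i → f i) a₁ v≡) (unbump-cong (cong₂ (λ f i → f i) a₂ v≡) hits≗) y)
    (trans (unbump-cong {A₁ x} refl (unbump-bump (A₂ x) (bump (A₁ x) (hits p))) y)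
    (unbump-bump (A₁ x) (hits p) y))
    where
    x : ℕ
    x = suc (length p)

  resolve-wp : ∀ {p x₁ x₂ x₃ x₄ s} → Closed p → length p < l → let x = suc (length p) in
    x₁ ≡ B₁ (A₁ x) → x₂ ≡ B₂ (A₁ x) → x₃ ≡ B₁ (A₂ x) → x₄ ≡ B₂ (A₂ x) →
    Verdict p (x₄ ∷ x₃ ∷ x₂ ∷ x₁ ∷ []) s → wp resolve (Descended p) s
  resolve-wp {p} c p<l refl refl refl refl
    ((fixed , m≡ , v≡ , hits≗ , outs≗) , inj₁ (ok≡ , p₂₂ ∷ p₁₂ ∷ p₂₁ ∷ p₁₁ ∷ [])) =
    (λ z → contradiction (trans (sym ok≡) z) λ ()) ,
    λ _ → inj₁ (passes⇒closed c p<l p₁₁ p₂₁ p₁₂ p₂₂ , fixed , m≡ , v≡ , hits≗ , outs≗)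
  resolve-wp {p} {s = s} c p<l refl refl refl refl
    ((fixed , m≡ , v≡ , hits≗ , outs≗) , inj₂ (ok≡ , x , ¬pass)) =
    (λ _ → inj₂ ((λ c′ → ¬pass λ ≢0 → c′ x (there (at-outs p ≢0))) ,
      fixed , m≡ , v≡ , uninclude-restores p s fixed v≡ hits≗ ,
      λ y → trans (cong (λ i → update (arrays s omit) i 1 y) v≡) (update-cong {i = suc (length p)} outs≗ refl y))) ,
    λ ≢0 → contradiction ok≡ ≢0

  descend-exec : ∀ {p s} → Closed p → length p < l → Node 0 p s →
    Exec descend s (time descend) (Silently (Descended p))
  descend-exec {p} {s} c p<l node =
    exec-seqˢ (after (wp-exec tryInclude {λ s → Trial p s × vars s ok ≡ 1} (tryInclude-wp {p} {s} node)) λ s (t , ok≡) →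
    exec-seqˢ (after (check-exec {p} e₁ (addresses s t .proj₁) (t , inj₁ (ok≡ , []))) λ s v →
    exec-seqˢ (after (check-exec {p} e₂ (addresses s (v .proj₁) .proj₂ .proj₁) v) λ s v →
    exec-seqˢ (after (check-exec {p} e₃ (addresses s (v .proj₁) .proj₂ .proj₂ .proj₁) v) λ s v →
    exec-seqˢ (after (check-exec {p} e₄ (addresses s (v .proj₁) .proj₂ .proj₂ .proj₂) v) λ s v →
    wp-exec resolve {Descended p} {s} (resolve-wp {p} {s = s} c p<l refl refl refl refl v))))))
    where
    x : ℕ
    x = suc (length p)
    e₁ e₂ e₃ e₄ : Expr
    e₁ = non¹ʳ ⟨ first ⟩
    e₂ = non²ʳ ⟨ first ⟩
    e₃ = non¹ʳ ⟨ second ⟩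
    e₄ = non²ʳ ⟨ second ⟩
    addresses : ∀ s → Trial p s → ⟦ e₁ ⟧ s ≡ B₁ (A₁ x) × ⟦ e₂ ⟧ s ≡ B₂ (A₁ x) ×
      ⟦ e₃ ⟧ s ≡ B₁ (A₂ x) × ⟦ e₄ ⟧ s ≡ B₂ (A₂ x)
    addresses s ((_ , _ , _ , a₁ , a₂ , b₁ , b₂) , _ , v≡ , _) rewrite a₁ | a₂ | b₁ | b₂ | v≡ =
      refl , refl , refl , refl

  Retreated : Path → State → Set
  Retreated p s = Closed (false ∷ p) × Node 0 (false ∷ p) s ⊎ ¬ Closed (false ∷ p) × Node 1 p s

  Restored : Path → State → Set
  Restored p s = Fixed s × vars s mode ≡ 1 × vars s vtx ≡ suc (length p) × vars s depth ≡ length p ×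
    arrays s blocks ≗ hits p × arrays s omit ≗ outs p

  turn-wp : ∀ p s → Restored p s → wp turn (Node 0 (false ∷ p)) s
  turn-wp p s (fixed , m≡ , v≡ , d≡ , hits≗ , outs≗) = fixed , refl , v≡ , hits≗ ,
    λ y → trans (cong (λ i → update (arrays s omit) i 1 y) v≡) (update-cong {i = suc (length p)} outs≗ refl y)

  retreat-include-wp : ∀ {p s} → Closed p → Node 1 (true ∷ p) s → wp retreat (Retreated p) s
  retreat-include-wp {p} {s} c (fixed , m≡ , d≡ , hits≗ , outs≗) =
    (λ _ → wp-mono uninclude {Restored p} {wp branches (Retreated p)} (λ {s} → choose {s}) {s₀}
      (fixed , m≡ , d≡ , cong pred d≡ , uninclude-restores p s₀ fixed d≡ hits≗ , outs≗)) ,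
    -- The other branch cannot occur: an included vertex has left no trace in `omit`.
    λ ≢0 → contradiction (trans (cong (arrays s omit) d≡) (trans (outs≗ x) (outs-fresh p))) ≢0
    where
    x : ℕ
    x = suc (length p)
    s₀ : State
    s₀ = setVar depth (pred (vars s depth)) (setVar vtx (vars s depth) s)
    branches : Program
    branches = if (blocks ⟨ first ⟩) == lit 0 then turn else
               if (blocks ⟨ second ⟩) == lit 0 then turn else skip
    choose : ∀ {s} → Restored p s → wp branches (Retreated p) s
    choose {s} restored@(fixed@(_ , _ , _ , a₁ , a₂ , _) , m≡ , v≡ , d≡ , hits≗ , outs≗) =
      (λ z → inj₁ (closed-exclude c (inj₁ (trans (sym first≡) z)) , turn-wp p s restored)) ,
      λ ≢₁ → (λ z → inj₁ (closed-exclude c (inj₂ (trans (sym second≡) z)) , turn-wp p s restored)) ,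
      λ ≢₂ → inj₂ ((λ c′ → [ ≢₁ ∘ trans first≡ , ≢₂ ∘ trans second≡ ]′ (excludable-head c′)) ,
        fixed , m≡ , d≡ , hits≗ , outs≗)
      where
      first≡ : ⟦ blocks ⟨ first ⟩ ⟧ s ≡ hits p (A₁ x)
      first≡ = trans (hits≗ _) (cong₂ (λ f i → hits p (f i)) a₁ v≡)
      second≡ : ⟦ blocks ⟨ second ⟩ ⟧ s ≡ hits p (A₂ x)
      second≡ = trans (hits≗ _) (cong₂ (λ f i → hits p (f i)) a₂ v≡)

  retreat-exclude-wp : ∀ {p s} → Node 1 (false ∷ p) s → wp retreat (Node 1 p) s
  retreat-exclude-wp {p} {s} (fixed , m≡ , d≡ , hits≗ , outs≗) =
    (λ z → contradiction (trans (sym (update-≡ (outs p) x)) (trans (sym (outs≗ x)) (trans (cong (arrays s omit) (sym d≡)) z))) λ ()) ,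
    λ _ → fixed , m≡ , cong pred d≡ , hits≗ , λ y →
      trans (cong (λ i → update (arrays s omit) i 0 y) d≡)
      (trans (update-cong {i = x} outs≗ refl y)
      (trans (update-update {f = outs p} {i = x} y)
      (update-id {f = outs p} {i = x} (outs-fresh p) y)))
    where
    x : ℕ
    x = suc (length p)

  -- Output at a leaf

  Good : Path → Set
  Good p = 0 < length (zeros (outs p) l) × 0 < length (zeros (hits p) r)

  good? : ∀ p → Dec (Good p)
  good? p = 0 <? length (zeros (outs p) l) ×-dec 0 <? length (zeros (hits p) r)

  rendered printed : Path → List ℕ
  rendered p = (zeros (outs p) l ++ 0 ∷ []) ++ (zeros (hits p) r ++ 0 ∷ [])
  printed p = Bool.if does (good? p) then rendered p else []

  printed-good : ∀ {p} → Good p → printed p ≡ rendered p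
  printed-good {p} g rewrite dec-true (good? p) g = refl

  printed-bad : ∀ {p} → ¬ Good p → printed p ≡ []
  printed-bad {p} ¬g rewrite dec-false (good? p) ¬g = refl

  leaf-exec : ∀ p s → Node 0 p s →
    Exec leaf s (time leaf * suc (l + r)) (λ s′ o → Node 0 p s′ × o ≡ printed p)
  leaf-exec p s node =
    exec-seqˢᴺ {tally omit nˡ} (after (tally-exec omit (outs p) omits nˡ s node (node .proj₁ .proj₁) (m≤m+n l r))
      λ s (node , c≡) → exec-ifᴺ (lit 0 << var count)
        (λ 0<c → exec-seqˢᴺ {tally blocks nʳ} (after (tally-exec blocks (hits p) unblocked nʳ s node (node .proj₁ .proj₂ .proj₁) (m≤n+m r l))
          λ s (node , c′≡) → exec-ifᴺ (lit 0 << var count)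
            (λ 0<c′ → render s node (subst (0 <_) c≡ 0<c , subst (0 <_) c′≡ 0<c′))
            (λ 0≮c′ → nothing s node (λ (_ , 0<) → 0≮c′ (subst (0 <_) (sym c′≡) 0<)))))
        (λ 0≮c → nothing s node (λ (0< , _) → 0≮c (subst (0 <_) (sym c≡) 0<))))
    where
    open Scan (l + r) (Node 0 p) (λ _ _ k → k) (λ _ _ k → k)
    Q : State → List ℕ → Set
    Q s o = Node 0 p s × o ≡ printed p
    omits : ∀ s → Node 0 p s → arrays s omit ≗ outs p
    omits _ (_ , _ , _ , _ , outs≗) = outs≗
    unblocked : ∀ s → Node 0 p s → arrays s blocks ≗ hits p
    unblocked _ (_ , _ , _ , hits≗ , _) = hits≗
    nothing : ∀ s → Node 0 p s → ¬ Good p → Exec skip s (time skip * suc (l + r)) Q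
    nothing s node ¬g = exec run-skip (scale 1) (node , sym (printed-bad {p} ¬g))
    render : ∀ s → Node 0 p s → Good p →
      Exec (list omit nˡ ⨾ list blocks nʳ) s (time (list omit nˡ ⨾ list blocks nʳ) * suc (l + r)) Q
    render s node g = exec-seqᴺ {list omit nˡ} {list blocks nʳ} (exec-weaken ≤-refl
      (λ { {s′} (node′ , refl) → exec-weaken ≤-refl (λ { (node″ , refl) → node″ , sym (printed-good {p} g) })
        (list-exec blocks (hits p) unblocked nʳ s′ node′ (node′ .proj₁ .proj₂ .proj₁) (m≤n+m r l)) })
      (list-exec omit (outs p) omits nˡ s node (node .proj₁ .proj₁) (m≤m+n l r)))

  -- Speaks of the entire remaining run of the loop, with its output exactly and its length up to a
  -- bound.
  record Halts (s : State) (T : ℕ) (o : List ℕ) : Set where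
    constructor halts
    field
      {final} : State
      {steps} : ℕ
      run     : Run search s final o steps
      bound   : steps ≤ T

  halts-≡ : ∀ {s T T′ o o′} → T ≤ T′ → o ≡ o′ → Halts s T o → Halts s T′ o′
  halts-≡ T≤T′ refl (halts run t≤) = halts run (≤-trans t≤ T≤T′)

  iterate : ∀ s {T U o o′} → vars s halted ≡ 0 →
    Exec body s T (λ s′ o₁ → o₁ ≡ o × Halts s′ U o′) → Halts s (costᵗ stay + (T + U)) (o ++ o′)
  iterate s h (exec run t≤ (refl , halts run′ t′≤)) =
    halts (run-loop (holds⇒true stay {s} h) run run′) (+-monoʳ-≤ (costᵗ stay) (+-mono-≤ t≤ t′≤))

  step : ∀ s {U o} → vars s halted ≡ 0 → Exec body s (time body) (Silently λ s′ → Halts s′ U o) →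
    Halts s (iterationCost + U) o
  step s {U} h e = halts-≡ (≤-reflexive (sym (+-assoc (costᵗ stay) (time body) U))) refl (iterate s h e)

  descend-step : ∀ p s {U o} → Closed p → length p < l → Node 0 p s →
    (∀ s′ → Descended p s′ → Halts s′ U o) → Halts s (iterationCost + U) o
  descend-step p s c p<l node@((l≡ , _ , h≡ , _) , m≡ , d≡ , _) next = step s h≡
    (exec-thenᵗ (var mode == lit 0) m≡ (exec-elseᵗ (var depth == var nˡ)
      (λ eq → <⇒≢ p<l (trans (sym d≡) (trans eq l≡))) (after (descend-exec c p<l node) next)))

  retreat-step : ∀ b p s {U o} → Node 1 (b ∷ p) s → (Q : State → Set) → wp retreat Q s →
    (∀ s′ → Q s′ → Halts s′ U o) → Halts s (iterationCost + U) o
  retreat-step b p s node@((l≡ , _ , h≡ , _) , m≡ , d≡ , _) Q w next = step s h≡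
    (exec-elseᵗ (var mode == lit 0) (λ eq → contradiction (trans (sym m≡) eq) λ ())
      (exec-elseᵗ (var depth == lit 0) (λ eq → contradiction (trans (sym d≡) eq) λ ())
        (after (wp-exec retreat {Q} w) next)))

  leaf-step : ∀ p s {U o} → length p ≡ l → Node 0 p s →
    (∀ s′ → Node 1 p s′ → Halts s′ U o) → Halts s ((iterationCost * suc (l + r)) + U) (printed p ++ o)
  leaf-step p s {U} {o} len node@((l≡ , _ , h≡ , _) , m≡ , d≡ , _) next = halts-≡ cost≤ refl (iterate s h≡
    (exec-thenᴺ (var mode == lit 0) m≡ (exec-thenᴺ (var depth == var nˡ) (trans d≡ (trans len (sym l≡)))
      (exec-seqᴺ {leaf} {mode ≔ lit 1} (exec-weaken ≤-refl
        (λ { {s′} ((fixed , _ , rest) , refl) → exec run-var (scale 2)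
          (++-identityʳ (printed p) , next (setVar mode 1 s′) (fixed , refl , rest)) })
        (leaf-exec p s node))))))
    where
    open ≤-Reasoning
    cost≤ : costᵗ stay + (time body * suc (l + r) + U) ≤ (iterationCost * suc (l + r)) + U
    cost≤ = begin
      costᵗ stay + (time body * suc (l + r) + U)                ≡⟨ +-assoc (costᵗ stay) (time body * suc (l + r)) U ⟨
      costᵗ stay + time body * suc (l + r) + U                  ≤⟨ +-monoˡ-≤ U (+-monoˡ-≤ (time body * suc (l + r)) (scale (costᵗ stay))) ⟩
      costᵗ stay * suc (l + r) + time body * suc (l + r) + U    ≡⟨ cong (_+ U) (*-distribʳ-+ (suc (l + r)) (costᵗ stay) (time body)) ⟨
      (iterationCost * suc (l + r)) + U                                              ∎

  outputs : List Path → List ℕ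
  outputs ps = concat (map printed ps)

  outputs-++ : ∀ ps qs → outputs (ps ++ qs) ≡ outputs ps ++ outputs qs
  outputs-++ ps qs = trans (cong concat (map-++ printed ps qs)) (sym (concat-++ (map printed ps) (map printed qs)))

  -- Three iterations for each of the `k` inner nodes on the way to a leaf, and one linear iteration
  -- at the leaf.
  leafShare : ℕ → ℕ
  leafShare k = k * (3 * iterationCost) + iterationCost * suc (l + r)

  -- The three summands `e` are the step away from the node and the returns from its included and
  -- its excluded child. The `m + n` leaves below each contribute `3 * e`, and one contribution
  -- suffices.
  node-budget : ∀ e b m n U → 1 ≤ m + n →
    e + (m * b + (e + (n * b + (e + U)))) ≤ (m + n) * (3 * e + b) + U
  node-budget e b m n U 1≤ = begin
    e + (m * b + (e + (n * b + (e + U))))   ≡⟨ solve 4 (λ e x y U → e :+ (x :+ (e :+ (y :+ (e :+ U)))) := con 1 :* (con 3 :* e) :+ (x :+ y) :+ U) refl e (m * b) (n * b) U ⟩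
    1 * (3 * e) + (m * b + n * b) + U       ≡⟨ cong (λ x → 1 * (3 * e) + x + U) (*-distribʳ-+ b m n) ⟨
    1 * (3 * e) + (m + n) * b + U           ≤⟨ +-monoˡ-≤ U (+-monoˡ-≤ ((m + n) * b) (*-monoˡ-≤ (3 * e) 1≤)) ⟩
    (m + n) * (3 * e) + (m + n) * b + U     ≡⟨ cong (_+ U) (*-distribˡ-+ (m + n) (3 * e) b) ⟨
    (m + n) * (3 * e + b) + U               ∎
    where
    open ≤-Reasoning
    open +-*-Solver

  -- In continuation style: `next` covers the run after the walk has come back to `p`. In the
  -- induction, the continuation of the included branch is the return step followed by the excluded
  -- branch.
  leaves-halts : ∀ k p s {U o} → k + length p ≡ l → Closed p → Node 0 p s →
    (∀ s′ → Node 1 p s′ → Halts s′ U o) →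
    Halts s (length (leaves k p) * leafShare k + U) (outputs (leaves k p) ++ o)
  leaves-halts zero p s {U} {o} len c node next = halts-≡
    (≤-reflexive (cong (_+ U) (sym (*-identityˡ (iterationCost * suc (l + r))))))
    (cong (_++ o) (sym (++-identityʳ (printed p)))) (leaf-step p s len node next)
  leaves-halts (suc k) p s {U} {o} len c node next = halts-≡
    (≤-trans (node-budget iterationCost b m n U 1≤m+n) (≤-reflexive
      (cong₂ (λ x y → x * y + U) (sym (length-++ (branch k (true ∷ p)))) (sym (+-assoc (3 * iterationCost) (k * (3 * iterationCost)) (iterationCost * suc (l + r)))))))
    (trans (sym (++-assoc (outputs (branch k (true ∷ p))) (outputs (branch k (false ∷ p))) o))
      (cong (_++ o) (sym (outputs-++ (branch k (true ∷ p)) (branch k (false ∷ p))))))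
    (descend-step p s c p<l node included)
    where
    b m n : ℕ
    b = leafShare k
    m = length (branch k (true ∷ p))
    n = length (branch k (false ∷ p))
    1≤m+n : 1 ≤ m + n
    1≤m+n = subst (1 ≤_) (length-++ (branch k (true ∷ p))) (leaves-nonempty (suc k) c)
    p<l : length p < l
    p<l = subst (length p <_) len (s≤s (m≤n+m (length p) k))
    len′ : k + suc (length p) ≡ l
    len′ = trans (+-suc k (length p)) len
    restˡ restʳ : List ℕ
    restʳ = outputs (branch k (false ∷ p)) ++ o
    restˡ = outputs (branch k (true ∷ p)) ++ restʳ

    excluded : ∀ s → Closed (false ∷ p) → Node 0 (false ∷ p) s → Halts s (n * b + (iterationCost + U)) restʳ
    excluded s c₀ node₀ = subst (λ ps → Halts s (length ps * b + (iterationCost + U)) (outputs ps ++ o)) (sym (branch-full k c₀))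
      (leaves-halts k (false ∷ p) s len′ c₀ node₀ λ s node₁ →
        retreat-step false p s node₁ (Node 1 p) (retreat-exclude-wp {p} {s} node₁) next)

    retreated : ∀ s → Retreated p s → Halts s (n * b + (iterationCost + U)) restʳ
    retreated s (inj₁ (c₀ , node₀))  = excluded s c₀ node₀
    -- No excluded branch exists, and the return from the included child has already led back to
    -- `p`; the rest of the budget stays unspent.
    retreated s (inj₂ (¬c₀ , node₁)) = halts-≡ (≤-trans (m≤n+m U iterationCost) (m≤n+m (iterationCost + U) (n * b)))
      (cong (λ ps → outputs ps ++ o) (sym (branch-empty k ¬c₀))) (next s node₁)

    included : ∀ s → Descended p s → Halts s (m * b + (iterationCost + (n * b + (iterationCost + U)))) restˡ
    included s (inj₁ (c₁ , node₁)) = subst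
      (λ ps → Halts s (length ps * b + (iterationCost + (n * b + (iterationCost + U)))) (outputs ps ++ restʳ)) (sym (branch-full k c₁))
      (leaves-halts k (true ∷ p) s len′ c₁ node₁ λ s node₁ →
        retreat-step true p s node₁ (Retreated p) (retreat-include-wp {p} {s} c node₁) retreated)
    -- A failed inclusion has moved on to the excluded child within the same iteration.
    included s (inj₂ (¬c₁ , node₀)) = halts-≡
      (≤-trans (m≤n+m (n * b + (iterationCost + U)) iterationCost) (m≤n+m (iterationCost + (n * b + (iterationCost + U))) (m * b)))
      (cong (λ ps → outputs ps ++ restʳ) (sym (branch-empty k ¬c₁)))
      (excluded s (closed-exclude c (must-exclude c ¬c₁)) node₀)

  finish : ∀ s → Node 1 [] s → Halts s (iterationCost + costᵗ stay) []
  finish s ((_ , _ , h≡ , _) , m≡ , d≡ , _) = step s h≡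
    (exec-elseᵗ (var mode == lit 0) (λ eq → contradiction (trans (sym m≡) eq) λ ())
      (exec-thenᵗ (var depth == lit 0) d≡ (after (wp-exec (halted ≔ lit 1) {λ s → vars s halted ≡ 1} refl)
        λ s h≡ → halts (run-stop (¬holds⇒false stay {s} λ eq → contradiction (trans (sym h≡) eq) λ ())) ≤-refl)))

  search-halts : ∀ s → Node 0 [] s →
    Halts s (length (leaves l []) * leafShare l + (iterationCost + costᵗ stay)) (outputs (leaves l []))
  search-halts s node = halts-≡ ≤-refl (++-identityʳ (outputs (leaves l [])))
    (leaves-halts l [] s (+-identityʳ l) (λ _ ()) node finish)

-- Preprocessing

markRow recordPair recordRow processRow preprocess main : Program

-- The stamp is the row number plus one, so stamps of earlier rows never match and `mark` need not
-- be cleared. `pos` is not reset either, because the lists of successive rows are contiguous.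
markRow =
  while var pos << (start ⟨ inc (var row) ⟩) loop
    (mark ⟨ target ⟨ var pos ⟩ ⟩≔ inc (var row) ⨾ pos ≔ inc (var pos))

-- One pair enters the tables of both sides; in each, the previous newest entry moves to the second
-- place.
recordPair =
  non²ˡ ⟨ inc (var row) ⟩≔ non¹ˡ ⟨ inc (var row) ⟩ ⨾ non¹ˡ ⟨ inc (var row) ⟩≔ inc (var col) ⨾
  non²ʳ ⟨ inc (var col) ⟩≔ non¹ʳ ⟨ inc (var col) ⟩ ⨾ non¹ʳ ⟨ inc (var col) ⟩≔ inc (var row)

recordRow =
  while var col << var nʳ loop
    ((if (mark ⟨ var col ⟩) == inc (var row) then skip else recordPair) ⨾ col ≔ inc (var col))

processRow = markRow ⨾ col ≔ lit 0 ⨾ recordRow ⨾ row ≔ inc (var row)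

preprocess = while var row << var nˡ loop processRow

-- Without edges there is nothing to print, and too little time to read all vertices.
main = if (start ⟨ var nˡ ⟩) == lit 0 then skip else
  (preprocess ⨾ blocks ⟨ lit 0 ⟩≔ lit 1 ⨾ search)

select-hit : ∀ P {n} → P (suc n) ≡ true → select P (suc n) ≡ suc n ∷ select P n
select-hit P eq rewrite eq = refl

select-miss : ∀ P {n} → P (suc n) ≡ false → select P (suc n) ≡ select P n
select-miss P eq rewrite eq = refl

-- Free of any degree bound: two places always hold the two newest entries. That these are all
-- entries is a separate matter.
record Newest (F¹ F² : ℕ → ℕ) (P : ℕ → Bool) (i n : ℕ) : Set where
  constructor newest
  field
    latest   : F¹ i ≡ load (select P n) 0
    previous : F² i ≡ load (select P n) 1

newest-skip : ∀ {F¹ F² P i n} → P (suc n) ≡ false → Newest F¹ F² P i n → Newest F¹ F² P i (suc n)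
newest-skip {F¹} {F²} {P} {i} eq (newest l p) =
  newest (trans l (cong (λ xs → load xs 0) miss)) (trans p (cong (λ xs → load xs 1) miss))
  where miss = sym (select-miss P eq)

newest-push : ∀ {F¹ F² P i n} → P (suc n) ≡ true → Newest F¹ F² P i n →
  Newest (update F¹ i (suc n)) (update F² i (F¹ i)) P i (suc n)
newest-push {F¹} {F²} {P} {i} eq (newest l _) = newest
  (trans (update-≡ F¹ i) (cong (λ xs → load xs 0) hit))
  (trans (update-≡ F² i) (trans l (cong (λ xs → load xs 1) hit)))
  where hit = sym (select-hit P eq)

newest-other : ∀ {F¹ F² P i j n w w′} → i ≢ j → Newest F¹ F² P j n →
  Newest (update F¹ i w) (update F² i w′) P j n
newest-other {F¹} {F²} i≢j (newest l p) = newest (trans (update-≢ F¹ i≢j) l) (trans (update-≢ F² i≢j) p)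

-- Filling the tables of non-neighbours

module Preprocess (l r : ℕ) (off tgt : ℕ → ℕ) (D : ℕ → ℕ → Bool)
  (degree : ∀ {u} → u < l → ∃[ d ] off u + d ≡ off (suc u) × d ≤ r)
  (D-hit : ∀ {u j} → u < l → off u ≤ j → j < off (suc u) → D (suc u) (suc (tgt j)) ≡ false)
  (D-miss : ∀ {u v} → u < l → v < r → (∀ j → off u ≤ j → j < off (suc u) → tgt j ≢ v) →
    D (suc u) (suc v) ≡ true)
  (off₀ : off 0 ≡ 0)
  where

  open Linear r

  Env : State → Set
  Env s = vars s nˡ ≡ l × vars s nʳ ≡ r × vars s halted ≡ 0 × vars s mode ≡ 0 × vars s depth ≡ 0 ×
    arrays s start ≡ off × arrays s target ≡ tgt ×
    (∀ x → arrays s blocks x ≡ 0) × (∀ x → arrays s omit x ≡ 0)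

  Leftʳ : State → ℕ → ℕ → Set
  Leftʳ s a n = Newest (arrays s non¹ˡ) (arrays s non²ˡ) (D (suc a)) (suc a) n

  Rightʳ : State → ℕ → ℕ → Set
  Rightʳ s b n = Newest (arrays s non¹ʳ) (arrays s non²ʳ) (λ a → D a (suc b)) (suc b) n

  -- The pairs treated so far, in row-by-row order, seen both from the rows and from the columns.
  Recorded : ℕ → ℕ → State → Set
  Recorded u v s =
    (∀ a → a < u → Leftʳ s a r) × Leftʳ s u v × (∀ a → u < a → Leftʳ s a 0) ×
    (∀ b → b < v → Rightʳ s b (suc u)) × (∀ b → v ≤ b → b < r → Rightʳ s b u)

  RowStart : ℕ → ℕ → State → Set
  RowStart u k s = Env s × vars s row ≡ u × u + k ≡ l × vars s pos ≡ off u ×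
    (∀ x → arrays s mark x ≤ u) × Recorded u 0 s

  Marking : ℕ → ℕ → State → Set
  Marking u k s = Env s × vars s row ≡ u × vars s pos + k ≡ off (suc u) × off u ≤ vars s pos ×
    (∀ x → arrays s mark x ≡ suc u × D (suc u) (suc x) ≡ false ⊎
           arrays s mark x ≤ u × (∀ j → off u ≤ j → j < vars s pos → tgt j ≢ x)) ×
    Recorded u 0 s

  Marked : ℕ → State → Set
  Marked u s = ∀ x → arrays s mark x ≡ suc u × D (suc u) (suc x) ≡ false ⊎
                     arrays s mark x ≤ u × (x < r → D (suc u) (suc x) ≡ true)

  Recording : ℕ → ℕ → State → Set
  Recording u k s = Env s × vars s row ≡ u × vars s pos ≡ off (suc u) × vars s col + k ≡ r ×
    Marked u s × Recorded u (vars s col) s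

  markRow-exec : ∀ u {k} s → u < l → RowStart u k s →
    Exec markRow s (time markRow * suc r) (Silently (Marking u 0))
  markRow-exec u s u<l (env , u≡ , _ , pos≡ , marks≤ , recorded) with d , off≡ , d≤r ← degree u<l =
    exec-weaken (loop≤ guard marker (m≤n⇒m≤1+n d≤r)) id
      (exec-whileˢ guard marker (time marker) (Marking u) (λ k {s} → step k s) (λ {s} → stop s) d
        (env , u≡ , trans (cong (_+ d) pos≡) off≡ , ≤-reflexive (sym pos≡) ,
         (λ x → inj₂ (marks≤ x , λ j ≤j j< → contradiction (≤-<-trans ≤j j<) (<-irrefl (sym pos≡)))) , recorded))
    where
    guard : Test
    guard = var pos << (start ⟨ inc (var row) ⟩)
    marker : Program
    marker = mark ⟨ target ⟨ var pos ⟩ ⟩≔ inc (var row) ⨾ pos ≔ inc (var pos)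
    end≡ : ∀ s → Env s → vars s row ≡ u → arrays s start (suc (vars s row)) ≡ off (suc u)
    end≡ s (_ , _ , _ , _ , _ , off≡ , _) u≡ = cong₂ (λ f i → f (suc i)) off≡ u≡
    stop : ∀ s → Marking u 0 s → ¬ Holds guard s
    stop s (env , u≡ , pos≡ , _) = <-irrefl (trans (sym (+-identityʳ _)) (trans pos≡ (sym (end≡ s env u≡))))
    step : ∀ k s → Marking u (suc k) s → Holds guard s × Exec marker s (time marker) (Silently (Marking u k))
    step k s (env@(_ , _ , _ , _ , _ , _ , tgt≡ , _) , u≡ , pos≡ , off≤ , marks , recorded) =
      subst (vars s pos <_) (sym (end≡ s env u≡)) pos< ,
      wp-exec marker {Marking u k} (env , u≡ , trans (sym (+-suc (vars s pos) k)) pos≡ , m≤n⇒m≤1+n off≤ , marks′ , recorded)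
      where
      pos< : vars s pos < off (suc u)
      pos< = subst (vars s pos <_) pos≡ (m<m+n (vars s pos) z<s)
      t : ℕ
      t = arrays s target (vars s pos)
      t≡ : t ≡ tgt (vars s pos)
      t≡ = cong (λ f → f (vars s pos)) tgt≡
      marks′ : ∀ x → update (arrays s mark) t (suc (vars s row)) x ≡ suc u × D (suc u) (suc x) ≡ false ⊎
        update (arrays s mark) t (suc (vars s row)) x ≤ u × (∀ j → off u ≤ j → j < suc (vars s pos) → tgt j ≢ x)
      marks′ x with t ≟ x
      ... | yes refl = inj₁ (trans (update-≡ (arrays s mark) t) (cong suc u≡) ,
                trans (cong (λ x → D (suc u) (suc x)) t≡) (D-hit u<l off≤ pos<))
      ... | no t≢x rewrite update-≢ (arrays s mark) {t} {x} {suc (vars s row)} t≢x with marks x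
      ...   | inj₁ hit = inj₁ hit
      ...   | inj₂ (≤u , miss) = inj₂ (≤u , λ j ≤j j< tgt≡x → missed j ≤j (m≤n⇒m<n∨m≡n (s≤s⁻¹ j<)) tgt≡x)
        where
        missed : ∀ j → off u ≤ j → j < vars s pos ⊎ j ≡ vars s pos → tgt j ≢ x
        missed j ≤j (inj₁ j<)   = miss j ≤j j<
        missed j ≤j (inj₂ refl) = t≢x ∘ trans t≡

  marked : ∀ u s → u < l → Marking u 0 s → Marked u s
  marked u s u<l (_ , _ , pos≡ , _ , marks , _) x with marks x
  ... | inj₁ hit = inj₁ hit
  ... | inj₂ (≤u , miss) = inj₂ (≤u , λ x<r → D-miss u<l x<r λ j ≤j j< →
    miss j ≤j (subst (j <_) (sym (trans (sym (+-identityʳ (vars s pos))) pos≡)) j<))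

  recordRow-exec : ∀ u s → Recording u r s →
    Exec recordRow s (time recordRow * suc r) (Silently (Recording u 0))
  recordRow-exec u s recording =
    exec-weaken (loop≤ guard pass (n≤1+n r)) id
      (exec-whileˢ guard pass (time pass) (Recording u) (λ k {s} → step k s) (λ {s} → stop s) r recording)
    where
    guard : Test
    guard = var col << var nʳ
    pass : Program
    pass = (if (mark ⟨ var col ⟩) == inc (var row) then skip else recordPair) ⨾ col ≔ inc (var col)
    stop : ∀ s → Recording u 0 s → ¬ Holds guard s
    stop s ((_ , r≡ , _) , _ , _ , col≡ , _) = <-irrefl (trans (sym (+-identityʳ _)) (trans col≡ (sym r≡)))
    step : ∀ k s → Recording u (suc k) s → Holds guard s × Exec pass s (time pass) (Silently (Recording u k))
    step k s (env@(_ , r≡ , _) , refl , pos≡ , col≡ , marks , recorded@(done , current , fresh , above , below)) =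
      subst (v <_) (sym r≡) v<r , wp-exec pass {Recording u k} (adjacent , nonadjacent)
      where
      v : ℕ
      v = vars s col
      v<r : v < r
      v<r = subst (v <_) col≡ (m<m+n v z<s)
      col′≡ : suc v + k ≡ r
      col′≡ = trans (sym (+-suc v k)) col≡
      adjacent : arrays s mark v ≡ suc u → Recording u k (setVar col (suc v) s)
      adjacent hit = env , refl , pos≡ , col′≡ , marks ,
        done , newest-skip D≡ current , fresh , above′ , λ b v<b → below b (<⇒≤ v<b)
        where
        D≡ : D (suc u) (suc v) ≡ false
        D≡ with marks v
        ... | inj₁ (_ , D≡)  = D≡
        ... | inj₂ (≤u , _) = contradiction (subst (_≤ u) hit ≤u) 1+n≰n
        above′ : ∀ b → b < suc v → Rightʳ s b (suc u)
        above′ b b< with m≤n⇒m<n∨m≡n (s≤s⁻¹ b<)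
        ... | inj₁ b<v  = above b b<v
        ... | inj₂ refl = newest-skip D≡ (below b ≤-refl v<r)
      nonadjacent : arrays s mark v ≢ suc u → wp recordPair (λ s → Recording u k (setVar col (suc (vars s col)) s)) s
      nonadjacent miss = env , refl , pos≡ , col′≡ , marks ,
        (λ a a<u → newest-other (λ eq → <⇒≢ a<u (sym (suc-injective eq))) (done a a<u)) ,
        newest-push D≡ current ,
        (λ a u<a → newest-other (λ eq → <⇒≢ u<a (suc-injective eq)) (fresh a u<a)) ,
        above′ ,
        λ b v<b b<r → newest-other (λ eq → <⇒≢ v<b (suc-injective eq)) (below b (<⇒≤ v<b) b<r)
        where
        D≡ : D (suc u) (suc v) ≡ true
        D≡ with marks v
        ... | inj₁ (hit , _) = contradiction hit miss
        ... | inj₂ (_ , D≡)  = D≡ v<r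
        above′ : ∀ b → b < suc v → Newest (update (arrays s non¹ʳ) (suc v) (suc u))
          (update (arrays s non²ʳ) (suc v) (arrays s non¹ʳ (suc v))) (λ a → D a (suc b)) (suc b) (suc u)
        above′ b b< with m≤n⇒m<n∨m≡n (s≤s⁻¹ b<)
        ... | inj₁ b<v  = newest-other (λ eq → <⇒≢ b<v (sym (suc-injective eq))) (above b b<v)
        ... | inj₂ refl = newest-push D≡ (below b ≤-refl v<r)

  processRow-exec : ∀ u k s → RowStart u (suc k) s →
    Exec processRow s (time processRow * suc r) (Silently (RowStart (suc u) k))
  processRow-exec u k s rowStart@(_ , _ , u≡ , _) =
    exec-seqˢᴺ {markRow} (after (markRow-exec u s u<l rowStart)
    λ { s marking@(env , row≡ , pos≡ , _ , _ , recorded) →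
    exec-wpᴺ (col ≔ lit 0) (exec-seqˢᴺ {recordRow}
    (after (recordRow-exec u (setVar col 0 s)
      (env , row≡ , trans (sym (+-identityʳ _)) pos≡ , refl , marked u s u<l marking , recorded))
    λ { s (env , row≡ , pos≡ , col≡ , marks , recorded) →
    wp-execᴺ (row ≔ inc (var row)) {RowStart (suc u) k} (env , cong suc row≡ , trans (sym (+-suc u k)) u≡ , pos≡ ,
      (λ x → [ (λ (eq , _) → ≤-reflexive eq) , (λ (≤u , _) → m≤n⇒m≤1+n ≤u) ]′ (marks x)) ,
      finished s (subst (λ v → Recorded u v s) (trans (sym (+-identityʳ _)) col≡) recorded)) })) })
    where
    u<l : u < l
    u<l = subst (u <_) u≡ (m<m+n u z<s)
    finished : ∀ s → Recorded u r s → Recorded (suc u) 0 s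
    finished s (done , current , fresh , above , _) =
      (λ a a< → [ done a , (λ { refl → current }) ]′ (m≤n⇒m<n∨m≡n (s≤s⁻¹ a<))) ,
      fresh (suc u) ≤-refl , (λ a a> → fresh a (<⇒≤ a>)) , (λ _ ()) , λ b _ b<r → above b b<r

  preprocess-exec : ∀ s → RowStart 0 l s →
    Exec preprocess s (l * (costᵗ (var row << var nˡ) + time processRow * suc r) + costᵗ (var row << var nˡ))
      (Silently (RowStart l 0))
  preprocess-exec s rowStart = after
    (exec-whileˢ (var row << var nˡ) processRow (time processRow * suc r) I (λ k {s} → step k s) (λ {s} → stop s) l (0 , rowStart))
    λ { s (u , rowStart@(_ , _ , u≡ , _)) → subst (λ u → RowStart u 0 s) (trans (sym (+-identityʳ u)) u≡) rowStart }
    where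
    I : ℕ → State → Set
    I k s = ∃[ u ] RowStart u k s
    step : ∀ k s → I (suc k) s → Holds (var row << var nˡ) s ×
      Exec processRow s (time processRow * suc r) (Silently (I k))
    step k s (u , rowStart@((l≡ , _) , refl , u≡ , _)) =
      subst (u <_) (trans u≡ (sym l≡)) (m<m+n u z<s) , after (processRow-exec u k s rowStart) (λ _ → suc u ,_)
    stop : ∀ s → I 0 s → ¬ Holds (var row << var nˡ) s
    stop s (u , (l≡ , _) , refl , u≡ , _) = <-irrefl (trans (sym (+-identityʳ _)) (trans u≡ (sym l≡)))

-- The input encoding

load-++ˡ : ∀ xs {ys q} → q < length xs → load (xs ++ ys) q ≡ load xs q
load-++ˡ (x ∷ xs) {q = zero}  _  = refl
load-++ˡ (x ∷ xs) {q = suc q} q< = load-++ˡ xs (s≤s⁻¹ q<)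

load-++ʳ : ∀ xs {ys q} → load (xs ++ ys) (length xs + q) ≡ load ys q
load-++ʳ []       = refl
load-++ʳ (x ∷ xs) = load-++ʳ xs

load-applyUpTo : ∀ (f : ℕ → ℕ) {n k} → k < n → load (map f (upTo n)) k ≡ f k
load-applyUpTo f {n} = go f id n
  where
  go : ∀ (f g : ℕ → ℕ) n {k} → k < n → load (map f (Data.List.applyUpTo g n)) k ≡ f (g k)
  go f g (suc n) {zero}  _  = refl
  go f g (suc n) {suc k} k< = go f (g ∘ suc) n (s≤s⁻¹ k<)

load-∈ : ∀ xs {q} → q < length xs → load xs q ∈ₗ xs
load-∈ (x ∷ xs) {zero}  _  = here refl
load-∈ (x ∷ xs) {suc q} q< = there (load-∈ xs (s≤s⁻¹ q<))

∈-load : ∀ {xs x} → x ∈ₗ xs → ∃[ q ] q < length xs × load xs q ≡ x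
∈-load (here refl) = 0 , z<s , refl
∈-load (there x∈) with q , q< , eq ← ∈-load x∈ = suc q , s≤s q< , eq

load≢0⇒∈ : ∀ xs {q} → load xs q ≢ 0 → load xs q ∈ₗ xs
load≢0⇒∈ []               ≢0 = contradiction refl ≢0
load≢0⇒∈ (x ∷ xs) {zero}  ≢0 = here refl
load≢0⇒∈ (x ∷ xs) {suc q} ≢0 = there (load≢0⇒∈ xs ≢0)

∈-pair : ∀ {xs x} → length xs ≤ 2 → x ∈ₗ xs → load xs 0 ≡ x ⊎ load xs 1 ≡ x
∈-pair _ (here refl)                 = inj₁ refl
∈-pair _ (there (here refl))         = inj₂ refl
∈-pair (s≤s (s≤s ())) (there (there (here _)))
∈-pair (s≤s (s≤s ())) (there (there (there _)))

offset : ∀ {a b} → (Fin a → List (Fin b)) → ℕ → ℕ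
offset f k = length (concat (take k (tabulate f)))

load-offsets : ∀ {a b} (f : Fin a → List (Fin b)) {k} → k ≤ a → load (offsets f) k ≡ offset f k
load-offsets f k≤a = load-applyUpTo (offset f) (s≤s k≤a)

offset-suc : ∀ {a b} (f : Fin a → List (Fin b)) u → offset f (suc (toℕ u)) ≡ offset f (toℕ u) + length (f u)
offset-suc f zero = trans (length-++ (f zero)) (+-comm (length (f zero)) 0)
offset-suc f (suc u) = begin
  length (f zero ++ concat (take (suc (toℕ u)) (tabulate (f ∘ suc))))     ≡⟨ length-++ (f zero) ⟩
  length (f zero) + offset (f ∘ suc) (suc (toℕ u))                        ≡⟨ cong (length (f zero) +_) (offset-suc (f ∘ suc) u) ⟩
  length (f zero) + (offset (f ∘ suc) (toℕ u) + length (f (suc u)))       ≡⟨ +-assoc (length (f zero)) _ _ ⟨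
  length (f zero) + offset (f ∘ suc) (toℕ u) + length (f (suc u))         ≡⟨ cong (_+ length (f (suc u))) (length-++ (f zero)) ⟨
  offset f (suc (toℕ u)) + length (f (suc u))                             ∎
  where open ≡-Reasoning

load-targets : ∀ {a b} (f : Fin a → List (Fin b)) u {q} → q < length (f u) →
  load (targets f) (offset f (toℕ u) + q) ≡ load (map toℕ (f u)) q
load-targets f zero q< = load-++ˡ (map toℕ (f zero)) (subst (_ <_) (sym (length-map toℕ (f zero))) q<)
load-targets f (suc u) {q} q< = begin
  load (map toℕ (f zero) ++ targets (f ∘ suc)) (offset f (suc (toℕ u)) + q)
    ≡⟨ cong (load (map toℕ (f zero) ++ targets (f ∘ suc))) position ⟩
  load (map toℕ (f zero) ++ targets (f ∘ suc)) (length (map toℕ (f zero)) + (offset (f ∘ suc) (toℕ u) + q))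
    ≡⟨ load-++ʳ (map toℕ (f zero)) ⟩
  load (targets (f ∘ suc)) (offset (f ∘ suc) (toℕ u) + q)
    ≡⟨ load-targets (f ∘ suc) u q< ⟩
  load (map toℕ (f (suc u))) q ∎
  where
  open ≡-Reasoning
  position : offset f (suc (toℕ u)) + q ≡ length (map toℕ (f zero)) + (offset (f ∘ suc) (toℕ u) + q)
  position = trans (cong (_+ q) (length-++ (f zero))) (trans (+-assoc (length (f zero)) _ q)
    (cong (_+ (offset (f ∘ suc) (toℕ u) + q)) (sym (length-map toℕ (f zero)))))

offset-total : ∀ {a b} (f : Fin a → List (Fin b)) → offset f a ≡ 0 ⇔ (∀ u → length (f u) ≡ 0)
offset-total f = mk⇔ (to f) (from f)
  where
  to : ∀ {a b} (f : Fin a → List (Fin b)) → offset f a ≡ 0 → ∀ u → length (f u) ≡ 0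
  to f eq zero    = m+n≡0⇒m≡0 _ (trans (sym (length-++ (f zero))) eq)
  to f eq (suc u) = to (f ∘ suc) (m+n≡0⇒n≡0 (length (f zero)) (trans (sym (length-++ (f zero))) eq)) u
  from : ∀ {a b} (f : Fin a → List (Fin b)) → (∀ u → length (f u) ≡ 0) → offset f a ≡ 0
  from {zero}  f eq = refl
  from {suc a} f eq = trans (length-++ (f zero)) (cong₂ _+_ (eq zero) (from (f ∘ suc) (eq ∘ suc)))

module Encoding (G : BipartiteGraph) (biplex : IsBiplex 2 G) (A : AdjacencyLists G) where
  open BipartiteGraph G
  open AdjacencyLists A

  -- Arguments are shifted by one, since 0 stands for no vertex.
  nonadjacent : ℕ → ℕ → Bool
  nonadjacent (suc x) (suc y) with x <? l | y <? r
  ... | yes x<l | yes y<r = not (does (Adj? (fromℕ< x<l) (fromℕ< y<r)))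
  ... | _       | _       = false
  nonadjacent _ _ = false

  nonadjacent-toℕ : ∀ u v → nonadjacent (suc (toℕ u)) (suc (toℕ v)) ≡ not (does (Adj? u v))
  nonadjacent-toℕ u v with toℕ u <? l | toℕ v <? r
  ... | yes u<l | yes v<r rewrite fromℕ<-toℕ u u<l | fromℕ<-toℕ v v<r = refl
  ... | no u≮l  | _       = contradiction (toℕ<n u) u≮l
  ... | yes _   | no v≮r  = contradiction (toℕ<n v) v≮r

  adj⇒ : ∀ {u v} → Adj u v → nonadjacent (suc (toℕ u)) (suc (toℕ v)) ≡ false
  adj⇒ {u} {v} adj = trans (nonadjacent-toℕ u v) (cong not (dec-true (Adj? u v) adj))

  ¬adj⇒ : ∀ {u v} → ¬ Adj u v → nonadjacent (suc (toℕ u)) (suc (toℕ v)) ≡ true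
  ¬adj⇒ {u} {v} ¬adj = trans (nonadjacent-toℕ u v) (cong not (dec-false (Adj? u v) ¬adj))

  ⇒¬adj : ∀ {u v} → nonadjacent (suc (toℕ u)) (suc (toℕ v)) ≡ true → ¬ Adj u v
  ⇒¬adj eq adj = contradiction (trans (sym (adj⇒ adj)) eq) λ ()

  every : ∀ {n} (P : ℕ → Set) → (∀ (i : Fin n) → P (toℕ i)) → ∀ {k} → k < n → P k
  every P p k<n = subst P (toℕ-fromℕ< k<n) (p (fromℕ< k<n))

  positive : ∀ {n} (P : ℕ → Set) → (∀ (i : Fin n) → P (suc (toℕ i))) → ∀ {x} → 0 < x → x ≤ n → P x
  positive P p {suc x} _ x<n = every (P ∘ suc) p x<n

  off tgt : ℕ → ℕ
  off = load (offsets listˡ)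
  tgt = load (targets listˡ)

  off-toℕ : ∀ u → off (toℕ u) ≡ offset listˡ (toℕ u)
  off-toℕ u = load-offsets listˡ (<⇒≤ (toℕ<n u))

  off-suc : ∀ u → off (toℕ u) + length (listˡ u) ≡ off (suc (toℕ u))
  off-suc u = trans (cong (_+ length (listˡ u)) (off-toℕ u))
    (trans (sym (offset-suc listˡ u)) (sym (load-offsets listˡ (toℕ<n u))))

  listˡ-length : ∀ u → length (listˡ u) ≤ r
  listˡ-length u = subst (length (listˡ u) ≤_) (length-tabulate id)
    (unique⊆⇒length≤ (proj₁ (listˡ✓ u)) (λ {v} _ → ∈-allFin v))

  degree : ∀ {u} → u < l → ∃[ d ] off u + d ≡ off (suc u) × d ≤ r
  degree = every (λ u → ∃[ d ] off u + d ≡ off (suc u) × d ≤ r) λ u → length (listˡ u) , off-suc u , listˡ-length u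

  tgt-hit : ∀ u {j} → off (toℕ u) ≤ j → j < off (suc (toℕ u)) → nonadjacent (suc (toℕ u)) (suc (tgt j)) ≡ false
  tgt-hit u {j} ≤j j< with q , refl ← m≤n⇒∃[o]m+o≡n ≤j
    with v , v∈ , eq ← ∈-map⁻ toℕ (load-∈ (map toℕ (listˡ u)) (subst (q <_) (sym (length-map toℕ (listˡ u)))
      (+-cancelˡ-< (off (toℕ u)) q (length (listˡ u)) (subst (off (toℕ u) + q <_) (sym (off-suc u)) j<)))) =
    subst (λ x → nonadjacent (suc (toℕ u)) (suc x) ≡ false) (sym (trans tgt≡ eq)) (adj⇒ (Equivalence.to (proj₂ (listˡ✓ u) v) v∈))
    where
    tgt≡ : tgt (off (toℕ u) + q) ≡ load (map toℕ (listˡ u)) q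
    tgt≡ = trans (cong (λ x → tgt (x + q)) (off-toℕ u)) (load-targets listˡ u
      (+-cancelˡ-< (off (toℕ u)) q (length (listˡ u)) (subst (off (toℕ u) + q <_) (sym (off-suc u)) j<)))

  tgt-miss : ∀ u v → (∀ j → off (toℕ u) ≤ j → j < off (suc (toℕ u)) → tgt j ≢ toℕ v) →
    nonadjacent (suc (toℕ u)) (suc (toℕ v)) ≡ true
  tgt-miss u v miss = ¬adj⇒ λ adj → reached (∈-load (∈-map⁺ toℕ (Equivalence.from (proj₂ (listˡ✓ u) v) adj)))
    where
    reached : ¬ (∃[ q ] q < length (map toℕ (listˡ u)) × load (map toℕ (listˡ u)) q ≡ toℕ v)
    reached (q , q< , eq) = miss (off (toℕ u) + q) (m≤m+n _ q)
      (subst (off (toℕ u) + q <_) (off-suc u) (+-monoʳ-< (off (toℕ u)) q<′))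
      (trans (cong (λ x → tgt (x + q)) (off-toℕ u)) (trans (load-targets listˡ u q<′) eq))
      where
      q<′ : q < length (listˡ u)
      q<′ = subst (q <_) (length-map toℕ (listˡ u)) q<

  open Preprocess l r off tgt nonadjacent degree
    (λ u<l → every (λ u → ∀ {j} → off u ≤ j → j < off (suc u) → nonadjacent (suc u) (suc (tgt j)) ≡ false) (λ u → tgt-hit u) u<l)
    (λ {u} {v} u<l v<r → every (λ u → (∀ j → off u ≤ j → j < off (suc u) → tgt j ≢ v) → nonadjacent (suc u) (suc v) ≡ true)
      (λ u → every (λ v → (∀ j → off (toℕ u) ≤ j → j < off (suc (toℕ u)) → tgt j ≢ v) → nonadjacent (suc (toℕ u)) (suc v) ≡ true) (tgt-miss u) v<r) u<l)
    refl public

  -- The 2-biplex condition makes the two places of a table row suffice.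
  select-nonˡ : ∀ u → length (select (nonadjacent (suc (toℕ u))) r) ≤ 2
  select-nonˡ u = ≤-trans (unique⊆⇒length≤ (select-unique P r) sub)
    (subst (_≤ 2) (sym (length-map (suc ∘ toℕ) (nonNeighboursˡ u))) (proj₁ biplex u))
    where
    P : ℕ → Bool
    P = nonadjacent (suc (toℕ u))
    sub : select P r ⊆ₗ map (suc ∘ toℕ) (nonNeighboursˡ u)
    sub x∈ with 0<x , x≤r , px ← ∈-select⁻ P {r} x∈ =
      positive (λ x → P x ≡ true → x ∈ₗ map (suc ∘ toℕ) (nonNeighboursˡ u))
        (λ v eq → ∈-map⁺ (suc ∘ toℕ) (∈-filter⁺ (λ v → ¬? (Adj? u v)) (∈-allFin v) (⇒¬adj eq))) 0<x x≤r px

  select-nonʳ : ∀ v → length (select (λ x → nonadjacent x (suc (toℕ v))) l) ≤ 2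
  select-nonʳ v = ≤-trans (unique⊆⇒length≤ (select-unique P l) sub)
    (subst (_≤ 2) (sym (length-map (suc ∘ toℕ) (nonNeighboursʳ v))) (proj₂ biplex v))
    where
    P : ℕ → Bool
    P x = nonadjacent x (suc (toℕ v))
    sub : select P l ⊆ₗ map (suc ∘ toℕ) (nonNeighboursʳ v)
    sub x∈ with 0<x , x≤l , px ← ∈-select⁻ P {l} x∈ =
      positive (λ x → P x ≡ true → x ∈ₗ map (suc ∘ toℕ) (nonNeighboursʳ v))
        (λ u eq → ∈-map⁺ (suc ∘ toℕ) (∈-filter⁺ (λ u → ¬? (Adj? u v)) (∈-allFin u) (⇒¬adj eq))) 0<x x≤l px

  module Tables (s : State) (recorded : Recorded l 0 s) where
    A₁ A₂ B₁ B₂ : ℕ → ℕ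
    A₁ = arrays s non¹ˡ
    A₂ = arrays s non²ˡ
    B₁ = arrays s non¹ʳ
    B₂ = arrays s non²ʳ

    non⁺ : ∀ u v → ¬ Adj u v → A₁ (suc (toℕ u)) ≡ suc (toℕ v) ⊎ A₂ (suc (toℕ u)) ≡ suc (toℕ v)
    non⁺ u v ¬adj with newest p q ← proj₁ recorded (toℕ u) (toℕ<n u) rewrite p | q =
      ∈-pair (select-nonˡ u) (∈-select⁺ (nonadjacent (suc (toℕ u))) z<s (toℕ<n v) (¬adj⇒ ¬adj))

    non⁻ : ∀ u {x} → x ≢ 0 → A₁ (suc (toℕ u)) ≡ x ⊎ A₂ (suc (toℕ u)) ≡ x → ∃[ v ] x ≡ suc (toℕ v) × ¬ Adj u v
    non⁻ u {x} x≢0 eq = let 0<x , x≤r , px = ∈-select⁻ P {r} x∈ in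
      positive (λ x → P x ≡ true → ∃[ v ] x ≡ suc (toℕ v) × ¬ Adj u v) (λ v eq → v , refl , ⇒¬adj eq) 0<x x≤r px
      where
      P : ℕ → Bool
      P = nonadjacent (suc (toℕ u))
      x∈ : x ∈ₗ select P r
      x∈ with newest p q ← proj₁ recorded (toℕ u) (toℕ<n u) = [ (λ eq → listed (trans (sym eq) p)) , (λ eq → listed (trans (sym eq) q)) ]′ eq
        where
        listed : ∀ {i} → x ≡ load (select P r) i → x ∈ₗ select P r
        listed x≡ = subst (_∈ₗ select P r) (sym x≡) (load≢0⇒∈ (select P r) (x≢0 ∘ trans x≡))

    -- Both pairs of tables record the same relation, and the degree bound on the right side ensures
    -- that `x` has not been pushed out of the row of `v`.
    B-complete : ∀ {x v} → 0 < x → x ≤ l → v ≢ 0 → A₁ x ≡ v ⊎ A₂ x ≡ v → B₁ v ≡ x ⊎ B₂ v ≡ x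
    B-complete {v = y} 0<x x≤l y≢0 = positive (λ x → A₁ x ≡ y ⊎ A₂ x ≡ y → B₁ y ≡ x ⊎ B₂ y ≡ x) found 0<x x≤l
      where
      found : ∀ u → A₁ (suc (toℕ u)) ≡ y ⊎ A₂ (suc (toℕ u)) ≡ y → B₁ y ≡ suc (toℕ u) ⊎ B₂ y ≡ suc (toℕ u)
      found u eq with v , refl , ¬adj ← non⁻ u y≢0 eq
        with newest p q ← proj₂ (proj₂ (proj₂ (proj₂ recorded))) (toℕ v) z≤n (toℕ<n v) rewrite p | q =
        ∈-pair (select-nonʳ v) (∈-select⁺ (λ x → nonadjacent x (suc (toℕ v))) z<s (toℕ<n u) (¬adj⇒ ¬adj))

-- Correctness of the output

at-total : ∀ p {x} → 0 < x → x ≤ length p → At true x p ⊎ At false x p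
at-total []      0<x x≤ = contradiction (<-≤-trans 0<x x≤) λ ()
at-total (b ∷ p) {x} 0<x x≤ with m≤n⇒m<n∨m≡n x≤
at-total (true  ∷ p) 0<x x≤ | inj₂ eq = inj₁ (here eq)
at-total (false ∷ p) 0<x x≤ | inj₂ eq = inj₂ (here eq)
... | inj₁ x< = [ inj₁ ∘ there , inj₂ ∘ there ]′ (at-total p 0<x (s≤s⁻¹ x<))

at-lookup : ∀ {n} (S : Vec Bool n) p u → At (lookup S u) (suc (length p + toℕ u)) (toList S ʳ++ p)
at-lookup (b ∷ S) p zero    = at-ʳ++ (toList S) (here (cong suc (+-identityʳ (length p))))
at-lookup (b ∷ S) p (suc u) = subst (λ k → At (lookup S u) (suc k) (toList S ʳ++ b ∷ p))
  (sym (+-suc (length p) (toℕ u))) (at-lookup S (b ∷ p) u)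

constant-path : ∀ b p → (∀ x → ¬ At (not b) x p) → p ≡ replicate (length p) b
constant-path b     []          _  = refl
constant-path true  (true  ∷ p) ¬a = cong (true ∷_) (constant-path true p λ x → ¬a x ∘ there)
constant-path true  (false ∷ p) ¬a = contradiction (here refl) (¬a _)
constant-path false (true  ∷ p) ¬a = contradiction (here refl) (¬a _)
constant-path false (false ∷ p) ¬a = cong (false ∷_) (constant-path false p λ x → ¬a x ∘ there)

length-ʳ++ : ∀ {A : Set} (xs : List A) {ys} → length (xs ʳ++ ys) ≡ length xs + length ys
length-ʳ++ []       = refl
length-ʳ++ (x ∷ xs) = trans (length-ʳ++ xs) (+-suc (length xs) _)

∈-tabulate⇔ : ∀ {n} (f : Fin n → Bool) i → i ∈ Vec.tabulate f ⇔ f i ≡ true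
∈-tabulate⇔ f i = mk⇔ (λ i∈ → trans (sym (lookup∘tabulate f i)) ([]=⇒lookup i∈))
  (λ eq → lookup⇒[]= i _ (trans (lookup∘tabulate f i) eq))

subsetOf : ∀ {n} {P : Fin n → Set} → U.Decidable P → Subset n
subsetOf P? = Vec.tabulate (does ∘ P?)

∈-subsetOf : ∀ {n} {P : Fin n → Set} (P? : U.Decidable P) i → i ∈ subsetOf P? ⇔ P i
∈-subsetOf P? i = mk⇔ (λ i∈ → does⇒ (Equivalence.to (∈-tabulate⇔ (does ∘ P?) i) i∈))
  (λ p → Equivalence.from (∈-tabulate⇔ (does ∘ P?) i) (dec-true (P? i) p))
  where
  does⇒ : does (P? i) ≡ true → _
  does⇒ eq with P? i
  ... | yes p = p
  does⇒ () | no _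

∈-allSubsets : ∀ {n} (S : Subset n) → S ∈ₗ allSubsets n
∈-allSubsets []           = here refl
∈-allSubsets (outside ∷ S) = ∈-++⁺ˡ (∈-map⁺ (outside ∷_) (∈-allSubsets S))
∈-allSubsets {suc n} (inside ∷ S) = ∈-++⁺ʳ (map (outside ∷_) (allSubsets n)) (∈-map⁺ (inside ∷_) (∈-allSubsets S))

zeros⇔ : ∀ f n → 0 < length (zeros f n) ⇔ (∃[ u ] f (suc (toℕ {n} u)) ≡ 0)
zeros⇔ f n = mk⇔ to from
  where
  P : ℕ → Bool
  P x = f x ≡ᵇ 0
  to : 0 < length (zeros f n) → ∃[ u ] f (suc (toℕ {n} u)) ≡ 0
  to 0< with zeros f n in eq
  ... | suc x ∷ xs with 0<x , x≤n , px ← ∈-select⁻ P {n} {suc x} (subst (suc x ∈ₗ_) (sym eq) (here refl)) =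
    fromℕ< x≤n , ≡ᵇ⇒≡ _ 0 (Equivalence.from T-≡ (subst (λ k → (f (suc k) ≡ᵇ 0) ≡ true) (sym (toℕ-fromℕ< x≤n)) px))
  ... | zero ∷ xs with () ← proj₁ (∈-select⁻ P {n} {0} (subst (0 ∈ₗ_) (sym eq) (here refl)))
  from : (∃[ u ] f (suc (toℕ {n} u)) ≡ 0) → 0 < length (zeros f n)
  from (u , eq) with zeros f n | ∈-select⁺ P {n} z<s (toℕ<n u) (Equivalence.to T-≡ (≡⇒≡ᵇ (f (suc (toℕ u))) 0 eq))
  ... | _ ∷ _ | _ = z<s

concat-printed : ∀ {A : Set} {P : A → Set} (P? : U.Decidable P) (f : A → List ℕ) xs →
  concat (map (λ x → Bool.if does (P? x) then f x else []) xs) ≡ concat (map f (filter P? xs))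
concat-printed P? f [] = refl
concat-printed P? f (x ∷ xs) with does (P? x)
... | true  = cong (f x ++_) (concat-printed P? f xs)
... | false = concat-printed P? f xs

unique-map-apart : ∀ {A B : Set} {R : A → A → Set} {f : A → B} → ∀ {xs} →
  (∀ {x y} → x ∈ₗ xs → y ∈ₗ xs → R x y → f x ≢ f y) → AllPairs R xs → Unique (map f xs)
unique-map-apart h []           = []
unique-map-apart {f = f} {x ∷ xs} h (r ∷ rs) =
  All.tabulate (λ y∈ eq → let x′ , x′∈ , y≡ = ∈-map⁻ f y∈ in
    h (here refl) (there x′∈) (All.lookup r x′∈) (trans eq y≡))
  ∷ unique-map-apart (λ x∈ y∈ → h (there x∈) (there y∈)) rs

-- Maximal bicliques and their number

module Counting (G : BipartiteGraph) where
  open BipartiteGraph G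

  AllAdjacent : Subset r → Fin l → Set
  AllAdjacent T u = ∀ v → v ∈ T → Adj u v

  allAdjacent? : ∀ T → U.Decidable (AllAdjacent T)
  allAdjacent? T u = all? λ v → v ∈? T →-dec Adj? u v

  ∈-counted : ∀ {x} → IsMaximalBiclique G x →
    x ∈ₗ filter (isMaximalBiclique? G) (cartesianProduct (allSubsets l) (allSubsets r))
  ∈-counted {S , T} max = ∈-filter⁺ (isMaximalBiclique? G) (∈-cartesianProduct⁺ (∈-allSubsets S) (∈-allSubsets T)) max

  -- The witness is a closure: all neighbours of `u`, together with all common neighbours of these.
  -- A larger biclique still contains `u`, so its right side cannot grow, and then neither can its
  -- left side.
  edge⇒1≤β : ∀ {u v} → Adj u v → 1 ≤ β G
  edge⇒1≤β {u} {v} adj = nonempty (∈-counted {S , T} (biclique , maximal , (u , u∈S) , (v , v∈T)))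
    where
    nonempty : ∀ {A : Set} {x : A} {xs} → x ∈ₗ xs → 1 ≤ length xs
    nonempty (here _)  = z<s
    nonempty (there _) = z<s
    T : Subset r
    T = subsetOf (Adj? u)
    S : Subset l
    S = subsetOf (allAdjacent? T)
    biclique : IsBiclique G (S , T)
    biclique u = Equivalence.to (∈-subsetOf (allAdjacent? T) u)
    v∈T : v ∈ T
    v∈T = Equivalence.from (∈-subsetOf (Adj? u) v) adj
    u∈S : u ∈ S
    u∈S = Equivalence.from (∈-subsetOf (allAdjacent? T) u) λ v → Equivalence.to (∈-subsetOf (Adj? u) v)
    maximal : IsMaximal G (S , T)
    maximal S′ T′ biclique′ (S⊆ , T⊆) = cong₂ _,_
      (⊆-antisym S⊆ λ {u} u∈ → Equivalence.from (∈-subsetOf (allAdjacent? T) u) λ v v∈ → biclique′ u u∈ v (T⊆ v∈))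
      (⊆-antisym T⊆ λ {v} v∈ → Equivalence.from (∈-subsetOf (Adj? u) v) (biclique′ u (S⊆ u∈S) v v∈))

open Counting using (edge⇒1≤β) public

module Correctness (G : BipartiteGraph) (A₁ A₂ B₁ B₂ : ℕ → ℕ)
  (non⁺ : ∀ u v → ¬ BipartiteGraph.Adj G u v → A₁ (suc (toℕ u)) ≡ suc (toℕ v) ⊎ A₂ (suc (toℕ u)) ≡ suc (toℕ v))
  (non⁻ : ∀ u {x} → x ≢ 0 → A₁ (suc (toℕ u)) ≡ x ⊎ A₂ (suc (toℕ u)) ≡ x → ∃[ v ] x ≡ suc (toℕ v) × ¬ BipartiteGraph.Adj G u v)
  (B-complete : ∀ {x v} → 0 < x → x ≤ BipartiteGraph.l G → v ≢ 0 → A₁ x ≡ v ⊎ A₂ x ≡ v → B₁ v ≡ x ⊎ B₂ v ≡ x)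
  where

  open BipartiteGraph G
  open Counting G
  open Paths A₁ A₂
  open Search l r A₁ A₂ B₁ B₂ B-complete using (Good; good?; rendered; printed; outputs)

  leftSet : Path → Subset l
  leftSet p = Vec.tabulate λ u → outs p (suc (toℕ u)) ≡ᵇ 0

  rightSet : Path → Subset r
  rightSet p = Vec.tabulate λ v → hits p (suc (toℕ v)) ≡ᵇ 0

  vertexSet : Path → VertexSet G
  vertexSet p = leftSet p , rightSet p

  ≡ᵇ0⇔ : ∀ {m} → (m ≡ᵇ 0) ≡ true ⇔ m ≡ 0
  ≡ᵇ0⇔ {zero}  = mk⇔ (λ _ → refl) (λ _ → refl)
  ≡ᵇ0⇔ {suc m} = mk⇔ (λ ()) (λ ())

  ∈leftSet⁻ : ∀ {p u} → u ∈ leftSet p → outs p (suc (toℕ u)) ≡ 0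
  ∈leftSet⁻ {p} {u} u∈ = Equivalence.to ≡ᵇ0⇔ (Equivalence.to (∈-tabulate⇔ (λ u → outs p (suc (toℕ u)) ≡ᵇ 0) u) u∈)

  ∈leftSet⁺ : ∀ {p u} → outs p (suc (toℕ u)) ≡ 0 → u ∈ leftSet p
  ∈leftSet⁺ {p} {u} eq = Equivalence.from (∈-tabulate⇔ (λ u → outs p (suc (toℕ u)) ≡ᵇ 0) u) (Equivalence.from ≡ᵇ0⇔ eq)

  ∈rightSet⁻ : ∀ {p v} → v ∈ rightSet p → hits p (suc (toℕ v)) ≡ 0
  ∈rightSet⁻ {p} {v} v∈ = Equivalence.to ≡ᵇ0⇔ (Equivalence.to (∈-tabulate⇔ (λ v → hits p (suc (toℕ v)) ≡ᵇ 0) v) v∈)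

  ∈rightSet⁺ : ∀ {p v} → hits p (suc (toℕ v)) ≡ 0 → v ∈ rightSet p
  ∈rightSet⁺ {p} {v} eq = Equivalence.from (∈-tabulate⇔ (λ v → hits p (suc (toℕ v)) ≡ᵇ 0) v) (Equivalence.from ≡ᵇ0⇔ eq)

  at-true⇒∈ : ∀ {p u} → At true (suc (toℕ u)) p → u ∈ leftSet p
  at-true⇒∈ {p} {u} a = ∈leftSet⁺ {p} (decidable-stable (outs p (suc (toℕ u)) ≟ 0)
    λ ≢0 → contradiction (at-functional a (at-outs p ≢0)) λ ())

  at-false⇒∉ : ∀ {p u} → At false (suc (toℕ u)) p → ¬ u ∈ leftSet p
  at-false⇒∉ {p} a u∈ = outs-at a (∈leftSet⁻ {p} u∈)

  module _ {p : Path} (len : length p ≡ l) where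

    at-left : ∀ u → At true (suc (toℕ u)) p ⊎ At false (suc (toℕ u)) p
    at-left u = at-total p z<s (subst (suc (toℕ u) ≤_) (sym len) (toℕ<n u))

    vertex : ∀ (P : ℕ → Set) → (∀ (u : Fin l) → P (suc (toℕ u))) → ∀ {b x} → At b x p → P x
    vertex P f {x = suc x} a = subst (P ∘ suc) (toℕ-fromℕ< x<l) (f (fromℕ< x<l))
      where
      x<l : x < l
      x<l = subst (suc x ≤_) len (at-bounded a)
    vertex P f {x = zero} a = contradiction (at-positive a) λ ()

    ∈⇒at-true : ∀ {u} → u ∈ leftSet p → At true (suc (toℕ u)) p
    ∈⇒at-true {u} u∈ with at-left u
    ... | inj₁ a = a
    ... | inj₂ a = contradiction u∈ (at-false⇒∉ a)

    right-adjacent : ∀ {u v} → u ∈ leftSet p → v ∈ rightSet p → Adj u v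
    right-adjacent {u} {v} u∈ v∈ = decidable-stable (Adj? u v) λ ¬adj →
      let A₁≢ , A₂≢ = hits≡0⁻ p (∈rightSet⁻ {p} v∈) (∈⇒at-true u∈) in [ A₁≢ , A₂≢ ]′ (non⁺ u v ¬adj)

    adjacent-right : ∀ {v} → (∀ u → u ∈ leftSet p → Adj u v) → v ∈ rightSet p
    adjacent-right {v} adj = ∈rightSet⁺ {p} (hits≡0⁺ p (λ ()) λ a →
      vertex (λ x → At true x p → A₁ x ≢ suc (toℕ v) × A₂ x ≢ suc (toℕ v))
        (λ u a → (λ eq → clash u a (inj₁ eq)) , (λ eq → clash u a (inj₂ eq))) a a)
      where
      clash : ∀ u → At true (suc (toℕ u)) p → ¬ (A₁ (suc (toℕ u)) ≡ suc (toℕ v) ⊎ A₂ (suc (toℕ u)) ≡ suc (toℕ v))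
      clash u a eq with v′ , v≡ , ¬adj ← non⁻ u (λ ()) eq with refl ← toℕ-injective (suc-injective v≡) =
        ¬adj (adj u (at-true⇒∈ a))

    -- The zero counter behind the exclusion belongs to a real right vertex, because the counter at
    -- 0 is always positive.
    excluder : Closed p → ∀ {u} → At false (suc (toℕ u)) p → ∃[ v ] v ∈ rightSet p × ¬ Adj u v
    excluder closed {u} a = [ (λ z → found (inj₁ refl) z) , (λ z → found (inj₂ refl) z) ]′ (closed _ a)
      where
      found : ∀ {x} → A₁ (suc (toℕ u)) ≡ x ⊎ A₂ (suc (toℕ u)) ≡ x → hits p x ≡ 0 → ∃[ v ] v ∈ rightSet p × ¬ Adj u v
      found eq z with v , refl , ¬adj ← non⁻ u (hits≡0⇒≢0 p z) eq = v , ∈rightSet⁺ {p} z , ¬adj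

    -- An excluded vertex misses some vertex of the right side, so the left side cannot grow; the
    -- right side already consists of all common neighbours of the left side.
    closed⇒maximal : Closed p → IsBiclique G (vertexSet p) × IsMaximal G (vertexSet p)
    closed⇒maximal closed = (λ u u∈ v v∈ → right-adjacent u∈ v∈) , maximal
      where
      maximal : IsMaximal G (vertexSet p)
      maximal S T biclique (S⊆ , T⊆) = cong₂ _,_ (⊆-antisym S⊆ S⊇) (⊆-antisym T⊆ T⊇)
        where
        S⊇ : S ⊆ leftSet p
        S⊇ {u} u∈ with at-left u
        ... | inj₁ a = at-true⇒∈ a
        ... | inj₂ a with v , v∈ , ¬adj ← excluder closed a = contradiction (biclique u u∈ v (T⊆ v∈)) ¬adj
        T⊇ : T ⊆ rightSet p
        T⊇ {v} v∈ = adjacent-right λ u u∈ → biclique u (S⊆ u∈) v v∈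

    good⇒maximalBiclique : Closed p → Good p → IsMaximalBiclique G (vertexSet p)
    good⇒maximalBiclique closed (0<ˡ , 0<ʳ) with closed⇒maximal closed
      | Equivalence.to (zeros⇔ (outs p) l) 0<ˡ | Equivalence.to (zeros⇔ (hits p) r) 0<ʳ
    ... | biclique , maximal | u , u≡ | v , v≡ =
      biclique , maximal , (u , ∈leftSet⁺ {p} u≡) , (v , ∈rightSet⁺ {p} v≡)

    -- An empty left side means that nothing was included. An empty right side offers no reason for
    -- any exclusion, so everything was included.
    bad⇒constant : Closed p → ¬ Good p → p ≡ replicate l false ⊎ p ≡ replicate l true
    bad⇒constant closed ¬good with 0 <? length (zeros (outs p) l)
    ... | no ≮ = inj₁ (trans (constant-path false p λ x a → vertex (λ x → ¬ At true x p)
            (λ u a → ≮ (Equivalence.from (zeros⇔ (outs p) l) (u , ∈leftSet⁻ {p} (at-true⇒∈ a)))) a a)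
            (cong (λ k → replicate k false) len))
    ... | yes 0< = inj₂ (trans (constant-path true p λ x a → vertex (λ x → ¬ At false x p)
            (λ u a → let v , v∈ , _ = excluder closed a in
              ¬good (0< , Equivalence.from (zeros⇔ (hits p) r) (v , ∈rightSet⁻ {p} v∈))) a a)
            (cong (λ k → replicate k true) len))

  module _ (S : Subset l) where

    chosen : Path
    chosen = toList S ʳ++ []

    chosen-length : length chosen ≡ l
    chosen-length = trans (length-ʳ++ (toList S)) (trans (+-identityʳ _) (length-toList S))

    chosen-left : leftSet chosen ≡ S
    chosen-left = ⊆-antisym to from
      where
      to : leftSet chosen ⊆ S
      to {u} u∈ = lookup⇒[]= u S (at-functional (at-lookup S [] u) (∈⇒at-true chosen-length u∈))
      from : S ⊆ leftSet chosen
      from {u} u∈ = at-true⇒∈ (subst (λ b → At b (suc (toℕ u)) chosen) ([]=⇒lookup u∈) (at-lookup S [] u))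

  -- By maximality each side is the set of common neighbours of the other. So a vertex outside `S`
  -- misses some vertex of `T`, whose counter is 0, and this closes the path of `S`.
  complete : ∀ {S T} → IsMaximalBiclique G (S , T) →
    chosen S ∈ₗ leaves l [] × Good (chosen S) × vertexSet (chosen S) ≡ (S , T)
  complete {S} {T} (biclique , maximal , (u₀ , u₀∈) , (v₀ , v₀∈)) =
    subst (λ k → p ∈ₗ leaves k []) (length-toList S) (leaves⁺ (toList S) closed) ,
    (Equivalence.from (zeros⇔ (outs p) l) (u₀ , ∈leftSet⁻ {p} (subst (u₀ ∈_) (sym (chosen-left S)) u₀∈)) ,
     Equivalence.from (zeros⇔ (hits p) r) (v₀ , ∈rightSet⁻ {p} (T⊆ v₀∈))) ,
    cong₂ _,_ (chosen-left S) (cong proj₂ (sym T≡))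
    where
    p : Path
    p = chosen S
    len : length p ≡ l
    len = chosen-length S
    inS : ∀ {u} → u ∈ leftSet p → u ∈ S
    inS {u} = subst (u ∈_) (chosen-left S)
    T⊆ : T ⊆ rightSet p
    T⊆ {v} v∈ = adjacent-right {p} len λ u u∈ → biclique u (inS u∈) v v∈
    T≡ : (S , T) ≡ (S , rightSet p)
    T≡ = maximal S (rightSet p) (λ u u∈ v v∈ → right-adjacent {p} len (subst (u ∈_) (sym (chosen-left S)) u∈) v∈) (id , T⊆)
    common : Subset l
    common = subsetOf (allAdjacent? T)
    S≡ : (S , T) ≡ (common , T)
    S≡ = maximal common T (λ u → Equivalence.to (∈-subsetOf (allAdjacent? T) u))
      ((λ {u} u∈ → Equivalence.from (∈-subsetOf (allAdjacent? T) u) (biclique u u∈)) , id)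
    closed : Closed p
    closed x a = vertex len (λ x → At false x p → Excludable p x) (λ u a → blocked u a) a a
      where
      blocked : ∀ u → At false (suc (toℕ u)) p → Excludable p (suc (toℕ u))
      blocked u a =
        let v , ¬imp = ¬∀⟶∃¬ r (λ v → v ∈ T → Adj u v) (λ v → v ∈? T →-dec Adj? u v) ¬adj
            z = ∈rightSet⁻ {p} (T⊆ (decidable-stable (v ∈? T) λ v∉ → ¬imp λ v∈ → contradiction v∈ v∉))
        in [ (λ A≡ → inj₁ (trans (cong (hits p) A≡) z)) , (λ A≡ → inj₂ (trans (cong (hits p) A≡) z)) ]′
             (non⁺ u v λ adj → ¬imp λ _ → adj)
        where
        ¬adj : ¬ AllAdjacent T u
        ¬adj adj = at-false⇒∉ a (subst (u ∈_) (trans (sym (cong proj₁ S≡)) (sym (chosen-left S)))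
          (Equivalence.from (∈-subsetOf (allAdjacent? T) u) adj))

  leafPaths goodLeaves : List Path
  leafPaths = leaves l []
  goodLeaves = filter good? leafPaths

  leaf⁻ : ∀ {p} → p ∈ₗ leafPaths → Closed p × length p ≡ l
  leaf⁻ p∈ with closed , q , len , refl ← leaves⁻ l (λ _ ()) p∈ =
    closed , trans (length-ʳ++ q) (trans (+-identityʳ _) len)

  vertexSet-apart : ∀ {p q} → p ∈ₗ leafPaths → q ∈ₗ leafPaths → Apart p q → vertexSet p ≢ vertexSet q
  vertexSet-apart {p} {q} p∈ q∈ (x , a , b) eq =
    vertex (proj₂ (leaf⁻ p∈)) (λ x → At true x p → ¬ At false x q)
      (λ u a b → at-false⇒∉ b (subst (u ∈_) (cong proj₁ eq) (at-true⇒∈ a))) a a b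

  bicliques : List (VertexSet G)
  bicliques = map vertexSet goodLeaves

  bicliques-enumerate : Enumerates (IsMaximalBiclique G) bicliques
  bicliques-enumerate = unique , λ x → mk⇔ sound (λ max → let p∈ , good , eq = complete max in
      subst (_∈ₗ bicliques) eq (∈-map⁺ vertexSet (∈-filter⁺ good? p∈ good)))
    where
    unique : Unique bicliques
    unique = unique-map-apart (λ p∈ q∈ → vertexSet-apart (proj₁ (∈-filter⁻ good? {xs = leafPaths} p∈)) (proj₁ (∈-filter⁻ good? {xs = leafPaths} q∈)))
      (AllPairs.filter⁺ good? (leaves-apart l (λ _ ())))
    sound : ∀ {x} → x ∈ₗ bicliques → IsMaximalBiclique G x
    sound x∈ with p , p∈ , refl ← ∈-map⁻ vertexSet x∈ with p∈′ , good ← ∈-filter⁻ good? {xs = leafPaths} p∈ =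
      good⇒maximalBiclique (proj₂ (leaf⁻ p∈′)) (proj₁ (leaf⁻ p∈′)) good

  prints : ∀ p → Prints G (rendered p) (vertexSet p)
  prints p =
    let us , us-enum , us≡ = select-enumerates (λ x → outs p x ≡ᵇ 0) {l} {leftSet p} (∈-tabulate⇔ (λ u → outs p (suc (toℕ u)) ≡ᵇ 0))
        vs , vs-enum , vs≡ = select-enumerates (λ x → hits p x ≡ᵇ 0) {r} {rightSet p} (∈-tabulate⇔ (λ v → hits p (suc (toℕ v)) ≡ᵇ 0))
    in us , vs , us-enum , vs-enum ,
       trans (++-assoc (zeros (outs p) l) _ _) (cong₂ (λ xs ys → xs ++ 0 ∷ ys ++ 0 ∷ []) us≡ vs≡)

  outputs-print : PrintsMaximalBicliques G (outputs leafPaths)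
  outputs-print = bicliques , map rendered goodLeaves , bicliques-enumerate , pointwise goodLeaves ,
    concat-printed good? rendered leafPaths
    where
    pointwise : ∀ ps → Pointwise (Prints G) (map rendered ps) (map vertexSet ps)
    pointwise []       = []
    pointwise (p ∷ ps) = prints p ∷ pointwise ps

  goodLeaves≤β : length goodLeaves ≤ β G
  goodLeaves≤β = subst (_≤ β G) (length-map vertexSet goodLeaves)
    (unique⊆⇒length≤ (proj₁ bicliques-enumerate) (∈-counted ∘ Equivalence.to (proj₂ bicliques-enumerate _)))

  -- A leaf that is not printed has an empty side, and there is at most one for each side.
  leaves≤β+2 : length leafPaths ≤ 2 + β G
  leaves≤β+2 = ≤-trans (unique⊆⇒length≤ unique sub) (s≤s (s≤s goodLeaves≤β))
    where
    unique : Unique leafPaths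
    unique = AllPairs.map (λ { (x , a , b) refl → contradiction (at-functional a b) λ () }) (leaves-apart l (λ _ ()))
    sub : leafPaths ⊆ₗ (replicate l false ∷ replicate l true ∷ goodLeaves)
    sub {p} p∈ with good? p
    ... | yes good = there (there (∈-filter⁺ good? p∈ good))
    ... | no ¬good = [ (λ eq → here eq) , (λ eq → there (here eq)) ]′ (bad⇒constant (proj₂ (leaf⁻ p∈)) (proj₁ (leaf⁻ p∈)) ¬good)

-- Running time

-- Each row of the adjacency matrix consists of neighbours and at most two non-neighbours; the rows
-- are summed.
cells≤ : ∀ (G : BipartiteGraph) → IsBiplex 2 G → let open BipartiteGraph G in l * r ≤ size + l * 2
cells≤ G (few , _) = subst (λ k → k * r ≤ size + k * 2) (length-tabulate {n = l} id) (rows (allFin l))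
  where
  open BipartiteGraph G
  open ≤-Reasoning
  E? : U.Decidable (λ (u , v) → Adj u v)
  E? (u , v) = Adj? u v
  row≤ : ∀ u (vs : List (Fin r)) →
    length vs ≤ length (filter E? (map (u ,_) vs)) + length (filter (λ v → ¬? (Adj? u v)) vs)
  row≤ u []       = z≤n
  row≤ u (v ∷ vs) with Adj? u v
  ... | yes _ = s≤s (row≤ u vs)
  ... | no _  = subst (suc (length vs) ≤_) (sym (+-suc _ _)) (s≤s (row≤ u vs))
  rows : ∀ us → length us * r ≤ length (filter E? (cartesianProduct us (allFin r))) + length us * 2
  rows []       = z≤n
  rows (u ∷ us) = begin
    r + length us * r
      ≤⟨ +-mono-≤ (subst (_≤ e + length (nonNeighboursˡ u)) (length-tabulate {n = r} id) (row≤ u (allFin r))) (rows us) ⟩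
    e + length (nonNeighboursˡ u) + (f + length us * 2)
      ≤⟨ +-monoˡ-≤ (f + length us * 2) (+-monoʳ-≤ e (few u)) ⟩
    e + 2 + (f + length us * 2)
      ≡⟨ solve 3 (λ e f k → e :+ con 2 :+ (f :+ k) := (e :+ f) :+ (con 2 :+ k)) refl e f (length us * 2) ⟩
    e + f + (2 + length us * 2)
      ≡⟨ cong (_+ (2 + length us * 2)) (trans (cong length (filter-++ E? (map (u ,_) (allFin r)) _)) (length-++ (filter E? (map (u ,_) (allFin r))))) ⟨
    length (filter E? (cartesianProduct (u ∷ us) (allFin r))) + (2 + length us * 2) ∎
    where
    open +-*-Solver
    e f : ℕ
    e = length (filter E? (map (u ,_) (allFin r)))
    f = length (filter E? (cartesianProduct us (allFin r)))

-- With `n = l + r` and `M` the last factor, `l * r ≤ 3 * M` gives `3 * b`. As `2 + β ≤ 3 * β` and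
-- `1 + n ≤ 2 * n`, the search costs at most 3β leaves times (3 + 2)·n·s, whence 15.
budget : ∀ a b s d {l r m β leaves} → 1 ≤ l + r → 1 ≤ β → leaves ≤ 2 + β → l * r ≤ m + l * 2 →
  (l * (a + b * suc r) + d) + (leaves * (l * (3 * s) + s * suc (l + r)) + d)
    ≤ (a + b + 3 * b + 15 * s + d + d) * (m + (l + r) * β + 1)
budget a b s d {l} {r} {m} {β} {leaves} 1≤n 1≤β leaves≤ cells = begin
  (l * (a + b * suc r) + d) + (leaves * (l * (3 * s) + s * suc n) + d)
    ≡⟨ solve 8 (λ l a b r d k s n → (l :* (a :+ b :* (con 1 :+ r)) :+ d) :+ (k :* (l :* (con 3 :* s) :+ s :* (con 1 :+ n)) :+ d)
         := (a :+ b) :* l :+ b :* (l :* r) :+ (k :* (l :* (con 3 :* s) :+ s :* (con 1 :+ n))) :+ d :* con 1 :+ d :* con 1) refl l a b r d leaves s n ⟩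
  (a + b) * l + b * (l * r) + leaves * (l * (3 * s) + s * suc n) + d * 1 + d * 1
    ≤⟨ +-mono-≤ (+-mono-≤ (+-mono-≤ (+-mono-≤ (*-monoʳ-≤ (a + b) l≤M) (*-monoʳ-≤ b cells≤M)) search≤M) (*-monoʳ-≤ d 1≤M)) (*-monoʳ-≤ d 1≤M) ⟩
  (a + b) * M + b * (3 * M) + 15 * s * M + d * M + d * M
    ≡⟨ solve 5 (λ a b s d M → (a :+ b) :* M :+ b :* (con 3 :* M) :+ con 15 :* s :* M :+ d :* M :+ d :* M
         := (a :+ b :+ con 3 :* b :+ con 15 :* s :+ d :+ d) :* M) refl a b s d M ⟩
  (a + b + 3 * b + 15 * s + d + d) * M ∎
  where
  open ≤-Reasoning
  open +-*-Solver
  n M : ℕ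
  n = l + r
  M = m + n * β + 1
  nβ≤M : n * β ≤ M
  nβ≤M = ≤-trans (m≤n+m (n * β) m) (m≤m+n (m + n * β) 1)
  m≤M : m ≤ M
  m≤M = ≤-trans (m≤m+n m (n * β)) (m≤m+n (m + n * β) 1)
  1≤M : 1 ≤ M
  1≤M = m≤n+m 1 (m + n * β)
  l≤M : l ≤ M
  l≤M = ≤-trans (m≤m+n l r) (≤-trans (subst (_≤ n * β) (*-identityʳ n) (*-monoʳ-≤ n 1≤β)) nβ≤M)
  cells≤M : l * r ≤ 3 * M
  cells≤M = ≤-trans cells (≤-trans (+-mono-≤ m≤M (*-monoˡ-≤ 2 l≤M))
    (≤-reflexive (solve 1 (λ M → M :+ M :* con 2 := con 3 :* M) refl M)))
  search≤M : leaves * (l * (3 * s) + s * suc n) ≤ 15 * s * M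
  search≤M = begin
    leaves * (l * (3 * s) + s * suc n)
      ≤⟨ *-mono-≤ (≤-trans leaves≤ (+-monoˡ-≤ β (*-monoʳ-≤ 2 1≤β)))
           (+-mono-≤ (*-monoˡ-≤ (3 * s) (m≤m+n l r)) (*-monoʳ-≤ s (+-monoˡ-≤ n 1≤n))) ⟩
    (2 * β + β) * (n * (3 * s) + s * (n + n))
      ≡⟨ solve 3 (λ β n s → (con 2 :* β :+ β) :* (n :* (con 3 :* s) :+ s :* (n :+ n)) := con 15 :* s :* (n :* β)) refl β n s ⟩
    15 * s * (n * β)
      ≤⟨ *-monoʳ-≤ (15 * s) nβ≤M ⟩
    15 * s * M ∎

-- The costs that occur once: the test for edges, 1 for the branch not taken, the last guard of the
-- row loop, 3 for writing the positive entry 0, and the last iteration of the search with its final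
-- guard.
overhead : (g a s h : ℕ) → ℕ
overhead g a s h = g + 1 + a + 3 + (s + h)

factor : (g a b s h : ℕ) → ℕ
factor g a b s h = a + b + 3 * b + 15 * s + overhead g a s h + overhead g a s h

-- Granting all constants to both phases is wasteful but gives the symmetric shape of `budget`.
collect : ∀ x y e₁ e₂ e₃ e₄ e₅ → let d = e₁ + e₂ + e₃ + e₄ + e₅ in
  e₁ + (e₂ + (x + e₃ + (e₄ + (y + e₅)))) ≤ (x + d) + (y + d)
collect x y e₁ e₂ e₃ e₄ e₅ = subst (e₁ + (e₂ + (x + e₃ + (e₄ + (y + e₅)))) ≤_)
  (solve 7 (λ x y e₁ e₂ e₃ e₄ e₅ →
    e₁ :+ (e₂ :+ (x :+ e₃ :+ (e₄ :+ (y :+ e₅)))) :+ (e₁ :+ e₂ :+ e₃ :+ e₄ :+ e₅)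
    := (x :+ (e₁ :+ e₂ :+ e₃ :+ e₄ :+ e₅)) :+ (y :+ (e₁ :+ e₂ :+ e₃ :+ e₄ :+ e₅))) refl x y e₁ e₂ e₃ e₄ e₅)
  (m≤m+n _ _)
  where open +-*-Solver

total-budget : ∀ g a b s h {l r m β} → 1 ≤ l + r → 1 ≤ β → l * r ≤ m + l * 2 →
  g + (1 + (l * (a + b * suc r) + a + (3 + ((2 + β) * (l * (3 * s) + s * suc (l + r)) + (s + h)))))
    ≤ factor g a b s h * (m + (l + r) * β + 1)
total-budget g a b s h {l} {r} {m} {β} 1≤n 1≤β cells = ≤-trans
  (collect (l * (a + b * suc r)) ((2 + β) * (l * (3 * s) + s * suc (l + r))) g 1 a 3 (s + h))
  (budget a b s (overhead g a s h) {l} {r} {m} {β} 1≤n 1≤β ≤-refl cells)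

-- The summand 1 in the time bound is for graphs without edges: there `size` and `β` are 0, while
-- the test still takes time.
idle-budget : ∀ g a b s h x → g + 1 ≤ factor g a b s h * (x + 1)
idle-budget g a b s h x = begin
  g + 1                     ≤⟨ m≤m+n (g + 1) (a + 3 + (s + h)) ⟩
  g + 1 + (a + 3 + (s + h)) ≡⟨ trans (sym (+-assoc (g + 1) (a + 3) (s + h))) (cong (_+ (s + h)) (sym (+-assoc (g + 1) a 3))) ⟩
  overhead g a s h          ≤⟨ m≤n+m (overhead g a s h) (a + b + 3 * b + 15 * s + overhead g a s h) ⟩
  factor g a b s h          ≡⟨ *-identityʳ (factor g a b s h) ⟨
  factor g a b s h * 1      ≤⟨ *-monoʳ-≤ (factor g a b s h) (m≤n+m 1 x) ⟩
  factor g a b s h * (x + 1) ∎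
  where open ≤-Reasoning

-- Correctness and running time of the whole program

noEdges : Test
noEdges = (start ⟨ var nˡ ⟩) == lit 0

moreRows : Test
moreRows = var row << var nˡ

module _ (G : BipartiteGraph) (biplex : IsBiplex 2 G) (A : AdjacencyLists G) where
  open BipartiteGraph G
  open AdjacencyLists A
  open Encoding G biplex A

  s₀ : State
  s₀ = initial G A

  Correct : State → List ℕ → Set
  Correct _ o = PrintsMaximalBicliques G o

  listed⇒adj : ∀ u → length (listˡ u) ≢ 0 → ∃[ v ] Adj u v
  listed⇒adj u ≢0 with listˡ u | listˡ✓ u
  ... | []    | _      = contradiction refl ≢0
  ... | v ∷ _ | _ , ✓  = v , Equivalence.to (✓ v) (here refl)

  adj⇒listed : ∀ {u v} → Adj u v → length (listˡ u) ≢ 0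
  adj⇒listed {u} {v} adj eq with listˡ u | listˡ✓ u
  ... | []    | _ , ✓ with () ← Equivalence.from (✓ v) adj
  adj⇒listed adj () | _ ∷ _ | _

  total : ⟦ start ⟨ var nˡ ⟩ ⟧ s₀ ≡ offset listˡ l
  total = load-offsets listˡ ≤-refl

  nothing-to-print : Holds noEdges s₀ → PrintsMaximalBicliques G []
  nothing-to-print eq = [] , [] , ([] , λ x → mk⇔ (λ ()) none) , [] , refl
    where
    none : ∀ {x} → IsMaximalBiclique G x → x ∈ₗ []
    none (biclique , _ , (u , u∈) , (v , v∈)) =
      contradiction (Equivalence.to (offset-total listˡ) (trans (sym total) eq) u) (adj⇒listed (biclique u u∈ v v∈))

  some-edge : ¬ Holds noEdges s₀ → ∃[ u ] ∃[ v ] Adj u v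
  some-edge ≢0 with ¬∀⟶∃¬ l (λ u → length (listˡ u) ≡ 0) (λ u → length (listˡ u) ≟ 0)
    (λ all≡0 → ≢0 (trans total (Equivalence.from (offset-total listˡ) all≡0)))
  ... | u , ≢0 = u , listed⇒adj u ≢0

  search-exec : ∀ s → RowStart l 0 s →
    Exec (blocks ⟨ lit 0 ⟩≔ lit 1 ⨾ search) s
      (3 + ((2 + β G) * (l * (3 * iterationCost) + iterationCost * suc (l + r)) + (iterationCost + costᵗ stay)))
      Correct
  search-exec s ((l≡ , r≡ , h≡ , m≡ , d≡ , _ , _ , blocks≡0 , omit≡0) , _ , _ , _ , _ , recorded) =
    exec-seqˢ (exec run-entry ≤-refl (refl , exec run
      (≤-trans bound (+-monoˡ-≤ (iterationCost + costᵗ stay)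
        (*-monoˡ-≤ (l * (3 * iterationCost) + iterationCost * suc (l + r)) leaves≤β+2)))
      outputs-print))
    where
    open Tables s recorded
    open Correctness G A₁ A₂ B₁ B₂ non⁺ non⁻ B-complete
    open Search l r A₁ A₂ B₁ B₂ B-complete
    -- Writing 1 to entry 0 turns the zero array into `hits []`.
    open Halts (search-halts (setEntry blocks 0 1 s)
      ((l≡ , r≡ , h≡ , refl , refl , refl , refl) , m≡ , d≡ , update-cong {i = 0} blocks≡0 refl , omit≡0))

  idle-exec : Holds noEdges s₀ → Exec main s₀ (costᵗ noEdges + (1 + 0)) Correct
  idle-exec eq = exec-then noEdges {U = 0} eq (exec run-skip ≤-refl (nothing-to-print eq))

  busy-exec : ¬ Holds noEdges s₀ → Exec main s₀
    (costᵗ noEdges + (1 + (l * (costᵗ moreRows + time processRow * suc r) + costᵗ moreRows +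
      (3 + ((2 + β G) * (l * (3 * iterationCost) + iterationCost * suc (l + r)) + (iterationCost + costᵗ stay))))))
    Correct
  busy-exec ≢0 = exec-else noEdges {T = 1} ≢0 (exec-seqˢ (after (preprocess-exec s₀ start₀) search-exec))
    where
    start₀ : RowStart 0 l s₀
    start₀ = (refl , refl , refl , refl , refl , refl , refl , (λ _ → refl) , (λ _ → refl)) , refl , refl , refl ,
      (λ _ → z≤n) , (λ _ ()) , newest refl refl , (λ _ _ → newest refl refl) , (λ _ ()) , λ _ _ _ → newest refl refl

  main-exec : Exec main s₀
    (factor (costᵗ noEdges) (costᵗ moreRows) (time processRow) iterationCost (costᵗ stay) * (size + order * β G + 1)) Correct
  main-exec = decide (holds? noEdges s₀)
    where
    busy : ∃[ u ] ∃[ v ] Adj u v → ¬ Holds noEdges s₀ → Exec main s₀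
      (factor (costᵗ noEdges) (costᵗ moreRows) (time processRow) iterationCost (costᵗ stay) * (size + order * β G + 1)) Correct
    busy (u , v , adj) ≢0 = exec-weaken
      (total-budget (costᵗ noEdges) (costᵗ moreRows) (time processRow) iterationCost (costᵗ stay) {l} {r} {size} {β G}
        (≤-trans (s≤s z≤n) (≤-trans (toℕ<n u) (m≤m+n l r))) (edge⇒1≤β G adj) (cells≤ G biplex)) id (busy-exec ≢0)
    decide : Dec (Holds noEdges s₀) → Exec main s₀
      (factor (costᵗ noEdges) (costᵗ moreRows) (time processRow) iterationCost (costᵗ stay) * (size + order * β G + 1)) Correct
    decide (yes eq) = exec-weaken
      (idle-budget (costᵗ noEdges) (costᵗ moreRows) (time processRow) iterationCost (costᵗ stay) (size + order * β G)) id (idle-exec eq)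
    decide (no ≢0)  = busy (some-edge ≢0) ≢0

lemma3p1 : ∃[ p ] ∃[ c ] ((G : BipartiteGraph) → IsBiplex 2 G → (A : AdjacencyLists G) →
    ∃[ s ] ∃[ o ] ∃[ t ]
    Run p (initial G A) s o t ×
    PrintsMaximalBicliques G o ×
    t ≤ c * (BipartiteGraph.size G + BipartiteGraph.order G * β G + 1))
lemma3p1 = main , factor (costᵗ noEdges) (costᵗ moreRows) (time processRow) iterationCost (costᵗ stay) , λ G biplex A →
  let open Exec (main-exec G biplex A) in final , output , steps , run , post , bound
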